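{- Let $n$ be an even natural number. Then there is a partition of $\mathbb{F}_3^n$ into maximal $2$-caps.
   Context: $\mathbb{F}_3^n$ denotes $n$-dimensional affine space over the field with three elements. A $k$-dimensional flat is a $k$-dimensional affine subspace. A subset $C \subseteq \mathbb{F}_3^n$ is a $2$-cap if no three points of $C$ lie on a line ($1$-dimensional flat) and no four points of $C$ lie on a $2$-dimensional flat (equivalently, every subset of $C$ of size at most $4$ is affinely independent). A $2$-cap is maximal if it has the largest possible cardinality among all $2$-caps in $\mathbb{F}_3^n$. -}

module Defs where

open import Data.Nat using (ℕ; _≤_)
open import Data.Fin using (Fin; zero; suc)
open import Data.Vec using (Vec; replicate; zipWith; map)
open import Data.List using (List; length; lookup)
open import Data.List.Membership.Propositional using (_∈_)
open import Data.List.Relation.Unary.Unique.Propositional using (Unique)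
open import Data.List.Relation.Unary.All using (All)
open import Data.Product using (Σ; ∃; _×_)
open import Relation.Binary.PropositionalEquality using (_≡_; _≢_)
open import Relation.Nullary using (¬_)

F₃ : Set
F₃ = Fin 3

_+₃_ : F₃ → F₃ → F₃
zero +₃ y = y
suc zero +₃ zero = suc zero
suc zero +₃ suc zero = suc (suc zero)
suc zero +₃ suc (suc zero) = zero
suc (suc zero) +₃ zero = suc (suc zero)
suc (suc zero) +₃ suc zero = zero
suc (suc zero) +₃ suc (suc zero) = suc zero

_*₃_ : F₃ → F₃ → F₃
zero *₃ y = zero
suc zero *₃ y = y
suc (suc zero) *₃ zero = zero
suc (suc zero) *₃ suc zero = suc (suc zero)
suc (suc zero) *₃ suc (suc zero) = suc zero

Pt : ℕ → Set
Pt n = Vec F₃ n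

𝟎 : ∀ {n} → Pt n
𝟎 = replicate _ zero

_⊕_ : ∀ {n} → Pt n → Pt n → Pt n
_⊕_ = zipWith _+₃_

_·_ : ∀ {n} → F₃ → Pt n → Pt n
t · v = map (t *₃_) v

OnLine : ∀ {n} → Pt n → Pt n → Pt n → Set
OnLine a d x = Σ F₃ λ t → x ≡ a ⊕ (t · d)

LinIndep₂ : ∀ {n} → Pt n → Pt n → Set
LinIndep₂ d₁ d₂ = ∀ s t → (s · d₁) ⊕ (t · d₂) ≡ 𝟎 → (s ≡ zero) × (t ≡ zero)

OnPlane : ∀ {n} → Pt n → Pt n → Pt n → Pt n → Set
OnPlane a d₁ d₂ x = Σ F₃ λ s → Σ F₃ λ t → x ≡ (a ⊕ (s · d₁)) ⊕ (t · d₂)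

Collinear : ∀ {n} → Pt n → Pt n → Pt n → Set
Collinear {n} x y z =
  Σ (Pt n) λ a → Σ (Pt n) λ d → d ≢ 𝟎 × OnLine a d x × OnLine a d y × OnLine a d z

Coplanar : ∀ {n} → Pt n → Pt n → Pt n → Pt n → Set
Coplanar {n} w x y z =
  Σ (Pt n) λ a → Σ (Pt n) λ d₁ → Σ (Pt n) λ d₂ → LinIndep₂ d₁ d₂ ×
    OnPlane a d₁ d₂ w × OnPlane a d₁ d₂ x × OnPlane a d₁ d₂ y × OnPlane a d₁ d₂ z

-- A finite subset of F₃ⁿ is represented by a duplicate-free list.
-- 2-cap: no three (distinct) points on a line, no four (distinct) points on a 2-flat.
Is2Cap : ∀ {n} → List (Pt n) → Set
Is2Cap C =
  Unique C ×
  (∀ {x y z} → x ∈ C → y ∈ C → z ∈ C → x ≢ y → x ≢ z → y ≢ z → ¬ Collinear x y z) ×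
  (∀ {w x y z} → w ∈ C → x ∈ C → y ∈ C → z ∈ C →
     w ≢ x → w ≢ y → w ≢ z → x ≢ y → x ≢ z → y ≢ z → ¬ Coplanar w x y z)

IsMaximal2Cap : ∀ {n} → List (Pt n) → Set
IsMaximal2Cap {n} C = Is2Cap C × (∀ (D : List (Pt n)) → Is2Cap D → length D ≤ length C)

IsPartitionIntoMaximal2Caps : (n : ℕ) → List (List (Pt n)) → Set
IsPartitionIntoMaximal2Caps n Cs =
  All IsMaximal2Cap Cs ×
  (∀ (x : Pt n) → Σ (Fin (length Cs)) λ i → x ∈ lookup Cs i ×
       (∀ j → x ∈ lookup Cs j → j ≡ i))

{-# OPTIONS --safe #-}

-- A subset of 𝔽₃ⁿ is a 2-cap iff it is a Sidon set (a + b = c + d only for {a, b} = {c, d}), and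
-- since the differences of distinct points of a Sidon set of size k are distinct, k(k − 1) ≤ 3ⁿ.
-- For n = 2m this gives k ≤ 3ᵐ, and the bound is attained by the parabola {(u, u² + s)} over the
-- field with 3ᵐ elements; its translates, one for each s, partition 𝔽₃ⁿ.
--
-- The field is found inside R = 𝔽₃[X]/(X^q − X), q = 3ᵐ, in which every a satisfies a^q = a, so that
-- a^(q−1) is idempotent.  The product y of the X^(3^d) − X for 0 < d < m has degree less than q,
-- hence is nonzero.  Multiplying y^(q−1) by a^(q−1), for one a ∈ R after the other, unless the result
-- is 0, leads to an idempotent e with eR a field, of 3ᵏ elements say.  As the elements of eR are roots
-- of T^q − T, k ≤ m; as a^(3ᵏ) = a in eR by Fermat but (eX)^(3^d) ≠ eX for 0 < d < m, k ≥ m.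
module Submission where

open import Defs
open import Algebra.Bundles using (CommutativeMonoid; CommutativeSemiring)
open import Data.Empty using (⊥-elim)
open import Data.Fin using (Fin; zero; suc; combine; finToFun; funToFin; punchIn; remQuot)
import Data.Fin.Properties as Fin
open import Data.List as List using (List; []; _∷_; allFin; filter; foldr; length)
open import Data.List.Membership.Propositional using (_∈_; lose)
open import Data.List.Membership.Propositional.Properties
  using (∈-allFin; ∈-filter⁺; ∈-filter⁻; ∈-lookup; ∈-map⁺; ∈-map⁻)
open import Data.List.Membership.Propositional.Properties.WithK using (unique∧set⇒bag)
open import Data.List.Properties using (length-map; length-replicate; length-tabulate)
open import Data.List.Relation.Binary.BagAndSetEquality using (∼bag⇒↭)
open import Data.List.Relation.Binary.Disjoint.Propositional using (Disjoint)
open import Data.List.Relation.Binary.Permutation.Propositional using (_↭_; ↭⇒↭ₛ)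
open import Data.List.Relation.Binary.Permutation.Propositional.Properties using (↭-length)
open import Data.List.Relation.Binary.Permutation.Setoid.Properties using (foldr-commMonoid)
open import Data.List.Relation.Unary.All as All using (All; []; _∷_)
import Data.List.Relation.Unary.All.Properties as All
open import Data.List.Relation.Unary.AllPairs as AllPairs using (AllPairs; []; _∷_)
import Data.List.Relation.Unary.AllPairs.Properties as AllPairs
open import Data.List.Relation.Unary.Any as Any using (Any; here; there)
open import Data.List.Relation.Unary.Any.Properties using (lookup-index)
open import Data.List.Relation.Unary.Unique.Propositional using (Unique)
import Data.List.Relation.Unary.Unique.Propositional.Properties as Unique
open import Data.Nat as ℕ using (ℕ; zero; suc; _+_; _^_; _≤_; _<_; z≤n; s≤s)
open import Data.Nat.Divisibility using (_∣_; divides)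
import Data.Nat.Properties as ℕ
open import Data.Product using (Σ; ∃; _×_; _,_; proj₁; proj₂)
open import Data.Sum as Sum using (_⊎_; inj₁; inj₂; [_,_]′)
open import Data.Vec using (Vec; []; _∷_; _++_; _∷ʳ_; head; lookup; map; replicate; splitAt; tabulate; tail)
open import Data.Vec.Properties
  using (++-injective; ++-injectiveˡ; lookup-map; lookup-replicate; lookup-zipWith; lookup∘tabulate;
         tabulate-cong; tabulate∘lookup; ≡-dec)
open import Data.Vec.Relation.Unary.All using () renaming (All to VecAll; [] to []; _∷_ to _∷_)
open import Function using (_∘_; id)
open import Function.Bundles using (mk⇔)
open import Relation.Binary using (DecidableEquality)
open import Relation.Binary.PropositionalEquality
  using (_≡_; _≢_; refl; sym; trans; cong; cong₂; subst; setoid; isEquivalence; module ≡-Reasoning)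
open import Relation.Nullary using (¬_; Dec; yes; no)
open import Relation.Nullary.Decidable using (True; toWitness; from-no; from-yes; ¬?; _→-dec_)

-- Linear algebra over 𝔽₃

infixl 6 _:⊕_
infixl 7 _:·_
infix  4 _≟_

_≟_ : ∀ {n} → DecidableEquality (Pt n)
_≟_ = ≡-dec Fin._≟_

decode : ∀ n → Fin (3 ^ n) → Pt n
decode n i = tabulate (finToFun i)

encode : ∀ {n} → Pt n → Fin (3 ^ n)
encode v = funToFin (lookup v)

-- The functions agree only pointwise, so `cong` does not apply and the induction runs over the
-- digits.
funToFin-cong : ∀ {m n} {f g : Fin m → Fin n} → (∀ i → f i ≡ g i) → funToFin f ≡ funToFin g
funToFin-cong {zero}  f≗g = refl
funToFin-cong {suc m} f≗g = cong₂ combine (f≗g zero) (funToFin-cong (f≗g ∘ suc))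

decode-encode : ∀ {n} (v : Pt n) → decode n (encode v) ≡ v
decode-encode v = trans (tabulate-cong (Fin.finToFun-funToFin (lookup v))) (tabulate∘lookup v)

encode-decode : ∀ n i → encode (decode n i) ≡ i
encode-decode n i =
  trans (funToFin-cong (lookup∘tabulate (finToFun {3} {n} i))) (Fin.funToFin-finToFin {n} i)

encode-injective : ∀ {n} {u v : Pt n} → encode u ≡ encode v → u ≡ v
encode-injective {u = u} {v} eq =
  trans (sym (decode-encode u)) (trans (cong (decode _) eq) (decode-encode v))

decode-injective : ∀ n {i j} → decode n i ≡ decode n j → i ≡ j
decode-injective n {i} {j} eq =
  trans (sym (encode-decode n i)) (trans (cong encode eq) (encode-decode n j))

points : ∀ n → List (Pt n)
points n = List.map (decode n) (allFin (3 ^ n))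

∈-points : ∀ {n} (v : Pt n) → v ∈ points n
∈-points v = subst (_∈ points _) (decode-encode v) (∈-map⁺ (decode _) (∈-allFin (encode v)))

points-unique : ∀ n → Unique (points n)
points-unique n = Unique.map⁺ (decode-injective n) (Unique.allFin⁺ (3 ^ n))

length-points : ∀ n → length (points n) ≡ 3 ^ n
length-points n = trans (length-map (decode n) (allFin (3 ^ n))) (length-tabulate _)

lookup-ext : ∀ {n} {u v : Pt n} → (∀ i → lookup u i ≡ lookup v i) → u ≡ v
lookup-ext {u = u} {v} eq =
  trans (sym (tabulate∘lookup u)) (trans (tabulate-cong eq) (tabulate∘lookup v))

-- A decision procedure for linear Horn clauses over 𝔽₃

data Expr (k : ℕ) : Set where
  var  : Fin k → Expr k
  :0   : Expr k
  _:⊕_ : Expr k → Expr k → Expr k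
  _:·_ : F₃ → Expr k → Expr k

⟦_⟧ : ∀ {k n} → Expr k → Vec (Pt n) k → Pt n
⟦ var x  ⟧ ρ = lookup ρ x
⟦ :0     ⟧ ρ = 𝟎
⟦ e :⊕ f ⟧ ρ = ⟦ e ⟧ ρ ⊕ ⟦ f ⟧ ρ
⟦ c :· e ⟧ ρ = c · ⟦ e ⟧ ρ

⟦_⟧₃ : ∀ {k} → Expr k → Pt k → F₃
⟦ var x  ⟧₃ ρ = lookup ρ x
⟦ :0     ⟧₃ ρ = zero
⟦ e :⊕ f ⟧₃ ρ = ⟦ e ⟧₃ ρ +₃ ⟦ f ⟧₃ ρ
⟦ c :· e ⟧₃ ρ = c *₃ ⟦ e ⟧₃ ρ

-- Linear operations act coordinatewise, so a coordinate of a value depends only on that coordinate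
-- of the variables.
lookup-⟦⟧ : ∀ {k n} (e : Expr k) (ρ : Vec (Pt n) k) i →
            lookup (⟦ e ⟧ ρ) i ≡ ⟦ e ⟧₃ (map (λ v → lookup v i) ρ)
lookup-⟦⟧ (var x)  ρ i = sym (lookup-map x (λ v → lookup v i) ρ)
lookup-⟦⟧ :0       ρ i = lookup-replicate i zero
lookup-⟦⟧ (e :⊕ f) ρ i =
  trans (lookup-zipWith _+₃_ i (⟦ e ⟧ ρ) (⟦ f ⟧ ρ)) (cong₂ _+₃_ (lookup-⟦⟧ e ρ i) (lookup-⟦⟧ f ρ i))
lookup-⟦⟧ (c :· e) ρ i =
  trans (lookup-map i (c *₃_) (⟦ e ⟧ ρ)) (cong (c *₃_) (lookup-⟦⟧ e ρ i))

infix 4 _:=_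
pattern _:=_ e f = e , f

Equation : ℕ → Set
Equation k = Expr k × Expr k

Holds : ∀ {k n} → Vec (Pt n) k → Equation k → Set
Holds ρ (e := f) = ⟦ e ⟧ ρ ≡ ⟦ f ⟧ ρ

Holds₃ : ∀ {k} → Pt k → Equation k → Set
Holds₃ ρ (e := f) = ⟦ e ⟧₃ ρ ≡ ⟦ f ⟧₃ ρ

holds₃? : ∀ {k} (ρ : Pt k) E → Dec (Holds₃ ρ E)
holds₃? ρ (e := f) = ⟦ e ⟧₃ ρ Fin.≟ ⟦ f ⟧₃ ρ

valid? : ∀ {k} (hs : List (Equation k)) (c : Equation k) →
         Dec (All (λ ρ → All (Holds₃ ρ) hs → Holds₃ ρ c) (points k))
valid? hs c = All.all? (λ ρ → All.all? (holds₃? ρ) hs →-dec holds₃? ρ c) (points _)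

-- A Horn clause between linear equations holds in 𝔽₃ⁿ as soon as it holds in 𝔽₃,
-- where it is decided by exhausting the valuations.
horn : ∀ {k n} (hs : List (Equation k)) (c : Equation k) {_ : True (valid? hs c)} →
       (ρ : Vec (Pt n) k) → All (Holds ρ) hs → Holds ρ c
horn hs (e := f) {ok} ρ hyps = lookup-ext λ i →
  let ρᵢ = map (λ v → lookup v i) ρ in
  trans (lookup-⟦⟧ e ρ i)
    (trans (All.lookup (toWitness ok) (∈-points ρᵢ) (All.map (λ {E} → pointwise i E) hyps))
           (sym (lookup-⟦⟧ f ρ i)))
  where
  pointwise : ∀ i E → Holds ρ E → Holds₃ (map (λ v → lookup v i) ρ) E
  pointwise i (e := f) eq =
    trans (sym (lookup-⟦⟧ e ρ i)) (trans (cong (λ v → lookup v i) eq) (lookup-⟦⟧ f ρ i))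

pattern x₀ = var zero
pattern x₁ = var (suc zero)
pattern x₂ = var (suc (suc zero))
pattern x₃ = var (suc (suc (suc zero)))
pattern x₄ = var (suc (suc (suc (suc zero))))

pattern 1₃ = suc zero
pattern 2₃ = suc (suc zero)

⊕-assoc : ∀ {n} (u v w : Pt n) → (u ⊕ v) ⊕ w ≡ u ⊕ (v ⊕ w)
⊕-assoc u v w = horn [] (x₀ :⊕ x₁ :⊕ x₂ := x₀ :⊕ (x₁ :⊕ x₂)) (u ∷ v ∷ w ∷ []) []

⊕-comm : ∀ {n} (u v : Pt n) → u ⊕ v ≡ v ⊕ u
⊕-comm u v = horn [] (x₀ :⊕ x₁ := x₁ :⊕ x₀) (u ∷ v ∷ []) []

⊕-identityˡ : ∀ {n} (u : Pt n) → 𝟎 ⊕ u ≡ u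
⊕-identityˡ u = horn [] (:0 :⊕ x₀ := x₀) (u ∷ []) []

⊕-identityʳ : ∀ {n} (u : Pt n) → u ⊕ 𝟎 ≡ u
⊕-identityʳ u = horn [] (x₀ :⊕ :0 := x₀) (u ∷ []) []

⊕-triple : ∀ {n} (u : Pt n) → (u ⊕ u) ⊕ u ≡ 𝟎
⊕-triple u = horn [] (x₀ :⊕ x₀ :⊕ x₀ := :0) (u ∷ []) []

⊕-cancelˡ : ∀ {n} (u v w : Pt n) → u ⊕ v ≡ u ⊕ w → v ≡ w
⊕-cancelˡ u v w eq =
  horn ((x₀ :⊕ x₁ := x₀ :⊕ x₂) ∷ []) (x₁ := x₂) (u ∷ v ∷ w ∷ []) (eq ∷ [])

⊕-interchange : ∀ {n} (a b c d : Pt n) → (a ⊕ b) ⊕ (c ⊕ d) ≡ (a ⊕ c) ⊕ (b ⊕ d)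
⊕-interchange a b c d =
  horn [] ((x₀ :⊕ x₁) :⊕ (x₂ :⊕ x₃) := (x₀ :⊕ x₂) :⊕ (x₁ :⊕ x₃)) (a ∷ b ∷ c ∷ d ∷ []) []

additive-𝟎 : ∀ {k l} {f : Pt k → Pt l} → (∀ u v → f (u ⊕ v) ≡ f u ⊕ f v) → f 𝟎 ≡ 𝟎
additive-𝟎 {f = f} add = horn ((x₀ := x₀ :⊕ x₀) ∷ []) (x₀ := :0) (f 𝟎 ∷ [])
  (trans (cong f (sym (⊕-identityˡ 𝟎))) (add 𝟎 𝟎) ∷ [])

0·-≡𝟎 : ∀ {k} (v : Pt k) → zero · v ≡ 𝟎
0·-≡𝟎 v = horn [] (zero :· x₀ := :0) (v ∷ []) []

1·-≡ : ∀ {k} (v : Pt k) → 1₃ · v ≡ v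
1·-≡ v = horn [] (1₃ :· x₀ := x₀) (v ∷ []) []

2·-≡⊕ : ∀ {k} (v : Pt k) → 2₃ · v ≡ v ⊕ v
2·-≡⊕ v = horn [] (2₃ :· x₀ := x₀ :⊕ x₀) (v ∷ []) []

-- 𝔽₃ is a prime field: its scalars are 0, 1 and 1 + 1, so additivity already gives linearity.
additive-· : ∀ {k l} {f : Pt k → Pt l} → (∀ u v → f (u ⊕ v) ≡ f u ⊕ f v) → ∀ c v → f (c · v) ≡ c · f v
additive-· {f = f} add zero v = trans (cong f (0·-≡𝟎 v)) (trans (additive-𝟎 add) (sym (0·-≡𝟎 (f v))))
additive-· {f = f} add 1₃   v = trans (cong f (1·-≡ v)) (sym (1·-≡ (f v)))
additive-· {f = f} add 2₃   v = trans (cong f (2·-≡⊕ v)) (trans (add v v) (sym (2·-≡⊕ (f v))))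

·-distribˡ-⊕ : ∀ {k} c (u v : Pt k) → c · (u ⊕ v) ≡ (c · u) ⊕ (c · v)
·-distribˡ-⊕ zero u v = horn [] (zero :· (x₀ :⊕ x₁) := zero :· x₀ :⊕ zero :· x₁) (u ∷ v ∷ []) []
·-distribˡ-⊕ 1₃   u v = horn [] (1₃ :· (x₀ :⊕ x₁) := 1₃ :· x₀ :⊕ 1₃ :· x₁) (u ∷ v ∷ []) []
·-distribˡ-⊕ 2₃   u v = horn [] (2₃ :· (x₀ :⊕ x₁) := 2₃ :· x₀ :⊕ 2₃ :· x₁) (u ∷ v ∷ []) []

*₃-distribʳ-+₃ : ∀ s t x → (s +₃ t) *₃ x ≡ (s *₃ x) +₃ (t *₃ x)
*₃-distribʳ-+₃ = from-yes (Fin.all? λ s → Fin.all? λ t → Fin.all? λ x →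
  ((s +₃ t) *₃ x) Fin.≟ ((s *₃ x) +₃ (t *₃ x)))

·-distribʳ-+₃ : ∀ {n} s t (v : Pt n) → (s +₃ t) · v ≡ (s · v) ⊕ (t · v)
·-distribʳ-+₃ s t []      = refl
·-distribʳ-+₃ s t (x ∷ v) = cong₂ _∷_ (*₃-distribʳ-+₃ s t x) (·-distribʳ-+₃ s t v)

-- 2-caps and Sidon sets

AllPairs-lookup : ∀ {A : Set} {R : A → A → Set} {xs : List A} → AllPairs R xs → ∀ i j →
                  ¬ R (List.lookup xs i) (List.lookup xs j) →
                  ¬ R (List.lookup xs j) (List.lookup xs i) → i ≡ j
AllPairs-lookup (_ ∷ _)  zero    zero    _ _ = refl
AllPairs-lookup (r ∷ _)  zero    (suc j) p _ = ⊥-elim (p (All.lookup r (∈-lookup j)))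
AllPairs-lookup (r ∷ _)  (suc i) zero    _ q = ⊥-elim (q (All.lookup r (∈-lookup i)))
AllPairs-lookup (_ ∷ rs) (suc i) (suc j) p q = cong suc (AllPairs-lookup rs i j p q)

Unique-lookup-injective : ∀ {A : Set} {xs : List A} → Unique xs → ∀ {i j} →
                          List.lookup xs i ≡ List.lookup xs j → i ≡ j
Unique-lookup-injective u {i} {j} eq = AllPairs-lookup u i j (λ ne → ne eq) (λ ne → ne (sym eq))

-- Concluding with indices instead of points makes the family injective: x i = x k gives x i + x k =
-- x k + x k, hence i = k.
Sidon : ∀ {n k} → (Fin k → Pt n) → Set
Sidon x = ∀ i j k l → x i ⊕ x j ≡ x k ⊕ x l → i ≡ k ⊎ i ≡ l

remQuot-injective : ∀ {m} k {i j : Fin (m ℕ.* k)} → remQuot {m} k i ≡ remQuot k j → i ≡ j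
remQuot-injective {m} k {i} {j} eq =
  trans (sym (Fin.combine-remQuot {m} k i))
        (trans (cong (λ p → combine (proj₁ p) (proj₂ p)) eq) (Fin.combine-remQuot {m} k j))

-- The differences x i − x j with i ≠ j are pairwise distinct.
Sidon-bound : ∀ {n k} {x : Fin (suc k) → Pt n} → Sidon x → suc k ℕ.* k ≤ 3 ^ n
Sidon-bound {n} {k} {x} sidon =
  Fin.injective⇒≤ {f = encode ∘ difference ∘ remQuot k}
    (remQuot-injective k ∘ difference-injective _ _ ∘ encode-injective)
  where
  difference : Fin (suc k) × Fin k → Pt n
  difference (i , j) = x i ⊕ (2₃ · x (punchIn i j))

  difference-injective : ∀ p q → difference p ≡ difference q → p ≡ q
  difference-injective (i , j) (i′ , j′) eq with sidon i (punchIn i′ j′) i′ (punchIn i j)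
    (horn ((x₀ :⊕ 2₃ :· x₁ := x₂ :⊕ 2₃ :· x₃) ∷ []) (x₀ :⊕ x₃ := x₂ :⊕ x₁)
          (x i ∷ x (punchIn i j) ∷ x i′ ∷ x (punchIn i′ j′) ∷ []) (eq ∷ []))
  ... | inj₂ i≡ = ⊥-elim (Fin.punchInᵢ≢i i j (sym i≡))
  -- Once i = i′ the subtrahends agree; adding `x (punchIn i j′)` to both gives a relation whose two
  -- alternatives coincide.
  ... | inj₁ refl = cong (i ,_) (Fin.punchIn-injective i j j′ ([ id , id ]′
    (sidon _ (punchIn i j′) _ (punchIn i j′)
    (horn ((x₀ :⊕ 2₃ :· x₁ := x₀ :⊕ 2₃ :· x₂) ∷ []) (x₁ :⊕ x₂ := x₂ :⊕ x₂)
          (x i ∷ x (punchIn i j) ∷ x (punchIn i j′) ∷ []) (eq ∷ [])))))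

SidonSet : ∀ {n} → List (Pt n) → Set
SidonSet C = ∀ {a b c d} → a ∈ C → b ∈ C → c ∈ C → d ∈ C → a ⊕ b ≡ c ⊕ d → a ≡ c ⊎ a ≡ d

-- A relation between parameters carries over through φ to the points, where the Sidon property
-- applies. Points on an r-flat thus yield a Sidon family in 𝔽₃ʳ.
Sidon-coordinates : ∀ {n r} {C : List (Pt n)} → SidonSet C →
  (xs : List (Pt n)) → Unique xs → All (_∈ C) xs →
  (φ : Pt r → Pt n) → (∀ a b c d → a ⊕ b ≡ c ⊕ d → φ a ⊕ φ b ≡ φ c ⊕ φ d) →
  (σ : Fin (length xs) → Pt r) → (∀ i → List.lookup xs i ≡ φ (σ i)) → Sidon σ
Sidon-coordinates S xs u xs⊆C φ φ-sum σ coord i j k l eq =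
  [ inj₁ ∘ Unique-lookup-injective u , inj₂ ∘ Unique-lookup-injective u ]′
    (S (member i) (member j) (member k) (member l)
       (trans (cong₂ _⊕_ (coord i) (coord j))
         (trans (φ-sum (σ i) (σ j) (σ k) (σ l) eq) (sym (cong₂ _⊕_ (coord k) (coord l))))))
  where member = λ i → All.lookup xs⊆C (∈-lookup i)

-- Three such points would give a Sidon family in 𝔽₃ with 3 · 2 = 6 distinct differences, but there
-- are only 3 elements.
SidonSet⇒noCollinear : ∀ {n} {C : List (Pt n)} → SidonSet C →
  ∀ {x y z} → x ∈ C → y ∈ C → z ∈ C → x ≢ y → x ≢ z → y ≢ z → ¬ Collinear x y z
SidonSet⇒noCollinear {n} S {x} {y} {z} x∈ y∈ z∈ x≢y x≢z y≢z (p , d , _ , (r , ex) , (s , ey) , (t , ez)) =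
  from-no (6 ℕ.≤? 3) (Sidon-bound (Sidon-coordinates S (x ∷ y ∷ z ∷ [])
    ((x≢y ∷ x≢z ∷ []) ∷ (y≢z ∷ []) ∷ [] ∷ []) (x∈ ∷ y∈ ∷ z∈ ∷ []) φ φ-sum σ
    λ { zero → ex ; (suc zero) → ey ; (suc (suc zero)) → ez }))
  where
  φ : Pt 1 → Pt n
  φ (t ∷ []) = p ⊕ (t · d)

  φ⊕φ : ∀ a b → φ (a ∷ []) ⊕ φ (b ∷ []) ≡ (p ⊕ p) ⊕ ((a +₃ b) · d)
  φ⊕φ a b = trans (⊕-interchange p (a · d) p (b · d)) (cong ((p ⊕ p) ⊕_) (sym (·-distribʳ-+₃ a b d)))

  φ-sum : ∀ a b c d → a ⊕ b ≡ c ⊕ d → φ a ⊕ φ b ≡ φ c ⊕ φ d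
  φ-sum (a ∷ []) (b ∷ []) (c ∷ []) (e ∷ []) eq =
    trans (φ⊕φ a b) (trans (cong (λ v → (p ⊕ p) ⊕ (head v · d)) eq) (sym (φ⊕φ c e)))

  σ : Fin 3 → Pt 1
  σ zero             = r ∷ []
  σ (suc zero)       = s ∷ []
  σ (suc (suc zero)) = t ∷ []

-- The same count in a plane: 4 · 3 = 12 distinct differences among 9 elements.
SidonSet⇒noCoplanar : ∀ {n} {C : List (Pt n)} → SidonSet C →
  ∀ {w x y z} → w ∈ C → x ∈ C → y ∈ C → z ∈ C →
  w ≢ x → w ≢ y → w ≢ z → x ≢ y → x ≢ z → y ≢ z → ¬ Coplanar w x y z
SidonSet⇒noCoplanar {n} S {w} {x} {y} {z} w∈ x∈ y∈ z∈ w≢x w≢y w≢z x≢y x≢z y≢z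
  (p , d₁ , d₂ , _ , (sw , tw , ew) , (sx , tx , ex) , (sy , ty , ey) , (sz , tz , ez)) =
  from-no (12 ℕ.≤? 9) (Sidon-bound (Sidon-coordinates S (w ∷ x ∷ y ∷ z ∷ [])
    ((w≢x ∷ w≢y ∷ w≢z ∷ []) ∷ (x≢y ∷ x≢z ∷ []) ∷ (y≢z ∷ []) ∷ [] ∷ []) (w∈ ∷ x∈ ∷ y∈ ∷ z∈ ∷ []) φ φ-sum σ
    λ { zero → ew ; (suc zero) → ex ; (suc (suc zero)) → ey ; (suc (suc (suc zero))) → ez }))
  where
  φ : Pt 2 → Pt n
  φ (s ∷ t ∷ []) = (p ⊕ (s · d₁)) ⊕ (t · d₂)

  φ⊕φ : ∀ s t s′ t′ → φ (s ∷ t ∷ []) ⊕ φ (s′ ∷ t′ ∷ []) ≡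
        ((p ⊕ p) ⊕ ((s +₃ s′) · d₁)) ⊕ ((t +₃ t′) · d₂)
  φ⊕φ s t s′ t′ = begin
    φ (s ∷ t ∷ []) ⊕ φ (s′ ∷ t′ ∷ [])
      ≡⟨ horn [] ((x₀ :⊕ x₁ :⊕ x₂) :⊕ (x₀ :⊕ x₃ :⊕ x₄) := (x₀ :⊕ x₀) :⊕ (x₁ :⊕ x₃) :⊕ (x₂ :⊕ x₄))
              (p ∷ (s · d₁) ∷ (t · d₂) ∷ (s′ · d₁) ∷ (t′ · d₂) ∷ []) [] ⟩
    ((p ⊕ p) ⊕ ((s · d₁) ⊕ (s′ · d₁))) ⊕ ((t · d₂) ⊕ (t′ · d₂))
      ≡⟨ sym (cong₂ (λ u v → ((p ⊕ p) ⊕ u) ⊕ v) (·-distribʳ-+₃ s s′ d₁) (·-distribʳ-+₃ t t′ d₂)) ⟩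
    ((p ⊕ p) ⊕ ((s +₃ s′) · d₁)) ⊕ ((t +₃ t′) · d₂) ∎
    where open ≡-Reasoning

  φ-sum : ∀ a b c d → a ⊕ b ≡ c ⊕ d → φ a ⊕ φ b ≡ φ c ⊕ φ d
  φ-sum (a ∷ a′ ∷ []) (b ∷ b′ ∷ []) (c ∷ c′ ∷ []) (e ∷ e′ ∷ []) eq =
    trans (φ⊕φ a a′ b b′)
      (trans (cong (λ v → ((p ⊕ p) ⊕ (head v · d₁)) ⊕ (head (tail v) · d₂)) eq) (sym (φ⊕φ c c′ e e′)))

  σ : Fin 4 → Pt 2
  σ zero                   = sw ∷ tw ∷ []
  σ (suc zero)             = sx ∷ tx ∷ []
  σ (suc (suc zero))       = sy ∷ ty ∷ []
  σ (suc (suc (suc zero))) = sz ∷ tz ∷ []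

SidonSet⇒2Cap : ∀ {n} {C : List (Pt n)} → Unique C → SidonSet C → Is2Cap C
SidonSet⇒2Cap u S = u , SidonSet⇒noCollinear S , SidonSet⇒noCoplanar S

-- Since 2 = -1, the relation says a + c + d = 0. The line from a in direction c - a meets c and d
-- at parameters 1 and 2.
collinear-midpoint : ∀ {n} {a c d : Pt n} → a ≢ c → a ⊕ a ≡ c ⊕ d → Collinear a c d
collinear-midpoint {a = a} {c} {d} a≢c eq =
  a , c ⊕ (2₃ · a) ,
  (λ δ≡𝟎 → a≢c (horn ((x₁ :⊕ 2₃ :· x₀ := :0) ∷ []) (x₀ := x₁) (a ∷ c ∷ []) (δ≡𝟎 ∷ []))) ,
  (zero , horn [] (x₀ := x₀ :⊕ zero :· (x₁ :⊕ 2₃ :· x₀)) (a ∷ c ∷ []) []) ,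
  (1₃   , horn [] (x₁ := x₀ :⊕ 1₃ :· (x₁ :⊕ 2₃ :· x₀)) (a ∷ c ∷ []) []) ,
  (2₃   , horn ((x₀ :⊕ x₀ := x₁ :⊕ x₂) ∷ []) (x₂ := x₀ :⊕ 2₃ :· (x₁ :⊕ 2₃ :· x₀)) (a ∷ c ∷ d ∷ []) (eq ∷ []))

-- The plane through a in directions c - a and d - a contains b = a + (c - a) + (d - a).
coplanar-parallelogram : ∀ {n} {a b c d : Pt n} → a ≢ b → a ≢ c → a ≢ d → c ≢ d →
                         a ⊕ b ≡ c ⊕ d → Coplanar a b c d
coplanar-parallelogram {n} {a} {b} {c} {d} a≢b a≢c a≢d c≢d eq =
  a , c ⊕ (2₃ · a) , d ⊕ (2₃ · a) , independent ,
  (zero , zero , horn [] (x₀ := x₀ :⊕ zero :· (x₂ :⊕ 2₃ :· x₀) :⊕ zero :· (x₃ :⊕ 2₃ :· x₀)) ρ []) ,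
  (1₃ , 1₃ , horn (h ∷ []) (x₁ := x₀ :⊕ 1₃ :· (x₂ :⊕ 2₃ :· x₀) :⊕ 1₃ :· (x₃ :⊕ 2₃ :· x₀)) ρ (eq ∷ [])) ,
  (1₃ , zero , horn [] (x₂ := x₀ :⊕ 1₃ :· (x₂ :⊕ 2₃ :· x₀) :⊕ zero :· (x₃ :⊕ 2₃ :· x₀)) ρ []) ,
  (zero , 1₃ , horn [] (x₃ := x₀ :⊕ zero :· (x₂ :⊕ 2₃ :· x₀) :⊕ 1₃ :· (x₃ :⊕ 2₃ :· x₀)) ρ [])
  where
  ρ = a ∷ b ∷ c ∷ d ∷ []
  pattern h = x₀ :⊕ x₁ := x₂ :⊕ x₃
  comb : F₃ → F₃ → Equation 4
  comb s t = s :· (x₂ :⊕ 2₃ :· x₀) :⊕ t :· (x₃ :⊕ 2₃ :· x₀) := :0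

  -- Each nontrivial combination that vanishes makes two of the four points coincide.
  independent : LinIndep₂ (c ⊕ (2₃ · a)) (d ⊕ (2₃ · a))
  independent zero zero e = refl , refl
  independent zero 1₃ e = ⊥-elim (a≢d (horn (comb zero 1₃ ∷ []) (x₀ := x₃) ρ (e ∷ [])))
  independent zero 2₃ e = ⊥-elim (a≢d (horn (comb zero 2₃ ∷ []) (x₀ := x₃) ρ (e ∷ [])))
  independent 1₃ zero e = ⊥-elim (a≢c (horn (comb 1₃ zero ∷ []) (x₀ := x₂) ρ (e ∷ [])))
  independent 2₃ zero e = ⊥-elim (a≢c (horn (comb 2₃ zero ∷ []) (x₀ := x₂) ρ (e ∷ [])))
  independent 1₃ 1₃ e = ⊥-elim (a≢b (horn (comb 1₃ 1₃ ∷ h ∷ []) (x₀ := x₁) ρ (e ∷ eq ∷ [])))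
  independent 2₃ 2₃ e = ⊥-elim (a≢b (horn (comb 2₃ 2₃ ∷ h ∷ []) (x₀ := x₁) ρ (e ∷ eq ∷ [])))
  independent 1₃ 2₃ e = ⊥-elim (c≢d (horn (comb 1₃ 2₃ ∷ []) (x₂ := x₃) ρ (e ∷ [])))
  independent 2₃ 1₃ e = ⊥-elim (c≢d (horn (comb 2₃ 1₃ ∷ []) (x₂ := x₃) ρ (e ∷ [])))

-- A nontrivial relation a + b = c + d puts three points on a line if exactly one of a = b, c = d
-- holds, and four in a plane if neither does; if both hold, then a = c.
2Cap⇒SidonSet : ∀ {n} {C : List (Pt n)} → Is2Cap C → SidonSet C
2Cap⇒SidonSet (_ , noCollinear , noCoplanar) {a} {b} {c} {d} a∈ b∈ c∈ d∈ eq
  with a ≟ c | a ≟ d | a ≟ b | c ≟ d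
... | yes a≡c | _ | _ | _ = inj₁ a≡c
... | _ | yes a≡d | _ | _ = inj₂ a≡d
... | no a≢c | no a≢d | yes refl | yes refl =
  ⊥-elim (a≢c (horn ((x₀ :⊕ x₀ := x₁ :⊕ x₁) ∷ []) (x₀ := x₁) (a ∷ c ∷ []) (eq ∷ [])))
... | no a≢c | no a≢d | yes refl | no c≢d =
  ⊥-elim (noCollinear a∈ c∈ d∈ a≢c a≢d c≢d (collinear-midpoint a≢c eq))
... | no a≢c | no a≢d | no a≢b | yes refl =
  ⊥-elim (noCollinear c∈ a∈ b∈ (a≢c ∘ sym) c≢b a≢b (collinear-midpoint (a≢c ∘ sym) (sym eq)))
  where
  c≢b : c ≢ b
  c≢b refl = a≢c (horn ((x₀ :⊕ x₁ := x₁ :⊕ x₁) ∷ []) (x₀ := x₁) (a ∷ c ∷ []) (eq ∷ []))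
... | no a≢c | no a≢d | no a≢b | no c≢d =
  ⊥-elim (noCoplanar a∈ b∈ c∈ d∈ a≢b a≢c a≢d b≢c b≢d c≢d (coplanar-parallelogram a≢b a≢c a≢d c≢d eq))
  where
  b≢c : b ≢ c
  b≢c refl = a≢d (horn ((x₀ :⊕ x₁ := x₁ :⊕ x₂) ∷ []) (x₀ := x₂) (a ∷ b ∷ d ∷ []) (eq ∷ []))
  b≢d : b ≢ d
  b≢d refl = a≢c (horn ((x₀ :⊕ x₁ := x₂ :⊕ x₁) ∷ []) (x₀ := x₂) (a ∷ b ∷ c ∷ []) (eq ∷ []))

-- Used with q = 3^m: a Sidon set of k + 1 > q points would have more than q² distinct differences.
m<k⇒m*m<k*pred : ∀ {q k} → 0 < q → q < suc k → q ℕ.* q < suc k ℕ.* k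
m<k⇒m*m<k*pred {q} {k} 0<q (s≤s q≤k) = begin-strict
  q ℕ.* q     ≤⟨ ℕ.*-monoʳ-≤ q q≤k ⟩
  q ℕ.* k     <⟨ ℕ.m<n+m (q ℕ.* k) (ℕ.<-≤-trans 0<q q≤k) ⟩
  k + q ℕ.* k ≤⟨ ℕ.+-monoʳ-≤ k (ℕ.*-monoˡ-≤ k q≤k) ⟩
  k + k ℕ.* k ∎
  where open ℕ.≤-Reasoning

2Cap-length≤ : ∀ m {C : List (Pt (m + m))} → Is2Cap C → length C ≤ 3 ^ m
2Cap-length≤ m {[]}    _ = z≤n
2Cap-length≤ m {C@(_ ∷ xs)} cap = ℕ.≮⇒≥ λ 3^m<|C| → ℕ.<⇒≱ (m<k⇒m*m<k*pred (ℕ.m^n>0 3 m) 3^m<|C|)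
  (subst (length C ℕ.* length xs ≤_) (ℕ.^-distribˡ-+-* 3 m m) (Sidon-bound {x = List.lookup C} lookup-Sidon))
  where
  lookup-Sidon : Sidon (List.lookup C)
  lookup-Sidon i j k l eq =
    [ inj₁ ∘ Unique-lookup-injective (proj₁ cap) , inj₂ ∘ Unique-lookup-injective (proj₁ cap) ]′
      (2Cap⇒SidonSet cap (∈-lookup i) (∈-lookup j) (∈-lookup k) (∈-lookup l) eq)

-- Parabolas over a commutative algebra without zero divisors

-- Commutative 𝔽₃-algebras carried by 𝔽₃ⁿ itself. Compatibility with scalars follows from additivity
-- by `additive-·`.
record Algebra (n : ℕ) : Set where
  infixl 30 _*_
  field
    _*_ : Pt n → Pt n → Pt n
    𝟏 : Pt n
    *-assoc : ∀ u v w → (u * v) * w ≡ u * (v * w)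
    *-comm : ∀ u v → u * v ≡ v * u
    *-identityˡ : ∀ u → 𝟏 * u ≡ u
    *-distribˡ-⊕ : ∀ u v w → u * (v ⊕ w) ≡ (u * v) ⊕ (u * w)

  *-zeroʳ : ∀ u → u * 𝟎 ≡ 𝟎
  *-zeroʳ u = additive-𝟎 (*-distribˡ-⊕ u)

  *-distribʳ-⊕ : ∀ u v w → (v ⊕ w) * u ≡ (v * u) ⊕ (w * u)
  *-distribʳ-⊕ u v w =
    trans (*-comm (v ⊕ w) u) (trans (*-distribˡ-⊕ u v w) (cong₂ _⊕_ (*-comm u v) (*-comm u w)))

  -- Negation is doubling here, so semiring identities suffice; the solver does not know 3 = 0,
  -- which `horn` supplies where it is used.
  commutativeSemiring : CommutativeSemiring _ _
  commutativeSemiring = record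
    { Carrier = Pt n
    ; _≈_ = _≡_
    ; _+_ = _⊕_
    ; _*_ = _*_
    ; 0#  = 𝟎
    ; 1#  = 𝟏
    ; isCommutativeSemiring = record
      { isSemiring = record
        { isSemiringWithoutAnnihilatingZero = record
          { +-isCommutativeMonoid = record
            { isMonoid = record
              { isSemigroup = record
                { isMagma = record { isEquivalence = isEquivalence ; ∙-cong = cong₂ _⊕_ }
                ; assoc = ⊕-assoc
                }
              ; identity = ⊕-identityˡ , ⊕-identityʳ
              }
            ; comm = ⊕-comm
            }
          ; *-cong = cong₂ _*_
          ; *-assoc = *-assoc
          ; *-identity = *-identityˡ , λ u → trans (*-comm u 𝟏) (*-identityˡ u)
          ; distrib = *-distribˡ-⊕ , *-distribʳ-⊕
          }
        ; zero = (λ u → trans (*-comm 𝟎 u) (*-zeroʳ u)) , *-zeroʳ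
        }
      ; *-comm = *-comm
      }
    }

  open CommutativeSemiring commutativeSemiring public
    using (semiring; zeroˡ; *-identityʳ; *-commutativeMonoid)
  open CommutativeMonoid *-commutativeMonoid public
    using () renaming (commutativeSemigroup to *-commutativeSemigroup)

  NoZeroDivisors : Set
  NoZeroDivisors = ∀ u v → u * v ≡ 𝟎 → u ≡ 𝟎 ⊎ v ≡ 𝟎

++-⊕ : ∀ {m n} (u v : Pt m) (u′ v′ : Pt n) → (u ++ u′) ⊕ (v ++ v′) ≡ (u ⊕ v) ++ (u′ ⊕ v′)
++-⊕ []      []      u′ v′ = refl
++-⊕ (x ∷ u) (y ∷ v) u′ v′ = cong (_ ∷_) (++-⊕ u v u′ v′)

disjoint-parts⇒partition : ∀ {n} (Cs : List (List (Pt n))) → AllPairs Disjoint Cs →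
  (∀ x → Any (x ∈_) Cs) →
  ∀ x → Σ (Fin (length Cs)) λ i → x ∈ List.lookup Cs i × (∀ j → x ∈ List.lookup Cs j → j ≡ i)
disjoint-parts⇒partition Cs disjoint cover x =
  Any.index (cover x) , lookup-index (cover x) , λ j x∈ →
    AllPairs-lookup disjoint j (Any.index (cover x))
      (λ d → d (x∈ , lookup-index (cover x))) (λ d → d (lookup-index (cover x) , x∈))

module Parabolas {m} (A : Algebra m) (noZeroDivisors : Algebra.NoZeroDivisors A) where
  open Algebra A
  open import Algebra.Solver.Ring.NaturalCoefficients.Default commutativeSemiring
    using (solve; _:+_; _:*_) renaming (_:=_ to _:≈_)

  -- (u₁ − u₃) * (u₁ + u₃ − u₂ − u₄) = (u₁² − u₃²) − (u₄² − u₂²) = 0, as u₁ − u₃ = u₄ − u₂.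
  planar : ∀ u₁ u₂ u₃ u₄ → u₁ ⊕ u₂ ≡ u₃ ⊕ u₄ → (u₁ * u₁) ⊕ (u₂ * u₂) ≡ (u₃ * u₃) ⊕ (u₄ * u₄) →
           u₁ ≡ u₃ ⊎ u₁ ≡ u₄
  planar u₁ u₂ u₃ u₄ sum squares =
    [ (λ δ≡𝟎 → inj₁ (horn ((x₀ :⊕ x₁ :⊕ x₁ := :0) ∷ []) (x₀ := x₁) (u₁ ∷ u₃ ∷ []) (δ≡𝟎 ∷ [])))
    , (λ ε≡𝟎 → inj₂ (horn (((x₀ :⊕ x₂) :⊕ 2₃ :· (x₁ :⊕ x₃) := :0) ∷ (x₀ :⊕ x₁ := x₂ :⊕ x₃) ∷ []) (x₀ := x₃)
                          (u₁ ∷ u₂ ∷ u₃ ∷ u₄ ∷ []) (trans (cong ((u₁ ⊕ u₃) ⊕_) (2·-≡⊕ (u₂ ⊕ u₄))) ε≡𝟎 ∷ sum ∷ [])))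
    ]′ (noZeroDivisors δ ((u₁ ⊕ u₃) ⊕ ((u₂ ⊕ u₄) ⊕ (u₂ ⊕ u₄))) product)
    where
    δ = (u₁ ⊕ u₃) ⊕ u₃
    δ≡ : δ ≡ (u₄ ⊕ u₂) ⊕ u₂
    δ≡ = horn ((x₀ :⊕ x₁ := x₂ :⊕ x₃) ∷ []) (x₀ :⊕ x₂ :⊕ x₂ := x₃ :⊕ x₁ :⊕ x₁) (u₁ ∷ u₂ ∷ u₃ ∷ u₄ ∷ []) (sum ∷ [])
    -- (u - v)(u + v) = u² - v², with -v written as v + v; the cross terms add up to 3uv = 0.
    expand : ∀ u v → ((u ⊕ v) ⊕ v) * (u ⊕ v) ≡ (u * u) ⊕ ((v * v) ⊕ (v * v))
    expand u v = trans
      (solve 2 (λ u v → ((u :+ v) :+ v) :* (u :+ v) :≈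
                        (u :* u :+ (v :* v :+ v :* v)) :+ ((u :* v :+ u :* v) :+ u :* v)) refl u v)
      (horn [] (x₀ :⊕ (x₁ :⊕ x₁ :⊕ x₁) := x₀) ((u * u) ⊕ ((v * v) ⊕ (v * v)) ∷ u * v ∷ []) [])
    product : δ * ((u₁ ⊕ u₃) ⊕ ((u₂ ⊕ u₄) ⊕ (u₂ ⊕ u₄))) ≡ 𝟎
    product = begin
      δ * ((u₁ ⊕ u₃) ⊕ ((u₂ ⊕ u₄) ⊕ (u₂ ⊕ u₄)))
        ≡⟨ trans (*-distribˡ-⊕ _ _ _) (cong ((δ * (u₁ ⊕ u₃)) ⊕_) (*-distribˡ-⊕ _ _ _)) ⟩
      (δ * (u₁ ⊕ u₃)) ⊕ ((δ * (u₂ ⊕ u₄)) ⊕ (δ * (u₂ ⊕ u₄)))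
        ≡⟨ cong₂ (λ v w → v ⊕ (w ⊕ w)) (expand u₁ u₃)
             (trans (cong₂ _*_ δ≡ (⊕-comm u₂ u₄)) (expand u₄ u₂)) ⟩
      ((u₁ * u₁) ⊕ ((u₃ * u₃) ⊕ (u₃ * u₃))) ⊕
        (((u₄ * u₄) ⊕ ((u₂ * u₂) ⊕ (u₂ * u₂))) ⊕ ((u₄ * u₄) ⊕ ((u₂ * u₂) ⊕ (u₂ * u₂))))
        ≡⟨ horn ((x₀ :⊕ x₁ := x₂ :⊕ x₃) ∷ [])
             ((x₀ :⊕ (x₂ :⊕ x₂)) :⊕ ((x₃ :⊕ (x₁ :⊕ x₁)) :⊕ (x₃ :⊕ (x₁ :⊕ x₁))) := :0)
             (u₁ * u₁ ∷ u₂ * u₂ ∷ u₃ * u₃ ∷ u₄ * u₄ ∷ []) (squares ∷ []) ⟩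
      𝟎 ∎
      where open ≡-Reasoning

  onParabola : Pt m → Pt m → Pt (m + m)
  onParabola s u = u ++ ((u * u) ⊕ s)

  parabola : Pt m → List (Pt (m + m))
  parabola s = List.map (onParabola s) (points m)

  parabola-unique : ∀ s → Unique (parabola s)
  parabola-unique s = Unique.map⁺ (λ {u} {v} → ++-injectiveˡ u v) (points-unique m)

  parabola-SidonSet : ∀ s → SidonSet (parabola s)
  parabola-SidonSet s a∈ b∈ c∈ d∈ eq
    with u₁ , _ , refl ← ∈-map⁻ (onParabola s) a∈ | u₂ , _ , refl ← ∈-map⁻ (onParabola s) b∈
       | u₃ , _ , refl ← ∈-map⁻ (onParabola s) c∈ | u₄ , _ , refl ← ∈-map⁻ (onParabola s) d∈ =
    [ inj₁ ∘ cong (onParabola s) , inj₂ ∘ cong (onParabola s) ]′ (planar u₁ u₂ u₃ u₄ (proj₁ parts)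
      (horn ((x₀ :⊕ x₄ :⊕ (x₁ :⊕ x₄) := x₂ :⊕ x₄ :⊕ (x₃ :⊕ x₄)) ∷ []) (x₀ :⊕ x₁ := x₂ :⊕ x₃)
            (u₁ * u₁ ∷ u₂ * u₂ ∷ u₃ * u₃ ∷ u₄ * u₄ ∷ s ∷ []) (proj₂ parts ∷ [])))
    where
    parts = ++-injective (u₁ ⊕ u₂) (u₃ ⊕ u₄)
      (trans (sym (++-⊕ u₁ u₂ _ _)) (trans eq (++-⊕ u₃ u₄ _ _)))

  length-parabola : ∀ s → length (parabola s) ≡ 3 ^ m
  length-parabola s = trans (length-map (onParabola s) (points m)) (length-points m)

  parabola-maximal : ∀ s → IsMaximal2Cap (parabola s)
  parabola-maximal s = SidonSet⇒2Cap (parabola-unique s) (parabola-SidonSet s) ,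
    λ D cap → subst (length D ≤_) (sym (length-parabola s)) (2Cap-length≤ m cap)

  parabolas-disjoint : ∀ {s t} → s ≢ t → Disjoint (parabola s) (parabola t)
  parabolas-disjoint {s} {t} s≢t (p∈ , p∈′)
    with u , _ , refl ← ∈-map⁻ (onParabola s) p∈ | v , _ , eq ← ∈-map⁻ (onParabola t) p∈′
    with refl , eq′ ← ++-injective u v eq = s≢t (⊕-cancelˡ (u * u) s t eq′)

  parabolas-cover : ∀ p → Any (p ∈_) (List.map parabola (points m))
  parabolas-cover p with u , v , refl ← splitAt m p =
    -- The point (u, v) lies on the translate by s = v - u².
    lose (∈-map⁺ parabola (∈-points (v ⊕ (2₃ · (u * u)))))
      (subst (_∈ parabola (v ⊕ (2₃ · (u * u))))
        (cong (u ++_) (horn [] (x₀ :⊕ (x₁ :⊕ 2₃ :· x₀) := x₁) (u * u ∷ v ∷ []) []))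
        (∈-map⁺ (onParabola _) (∈-points u)))

  partition : ∃ λ Cs → IsPartitionIntoMaximal2Caps (m + m) Cs
  partition = List.map parabola (points m) ,
    All.map⁺ (All.universal parabola-maximal (points m)) ,
    disjoint-parts⇒partition _ (AllPairs.map⁺ (AllPairs.map parabolas-disjoint (points-unique m))) parabolas-cover

-- The algebra 𝔽₃[X]/(Xⁿ − r)

module Frobenius {n} (A : Algebra n) where
  open Algebra A
  open import Algebra.Properties.Semiring.Exp semiring public
    using (^-assocʳ) renaming (_^_ to _↑_)
  open import Algebra.Properties.CommutativeSemiring.Exp commutativeSemiring public using (^-distrib-*)
  open import Algebra.Solver.Ring.NaturalCoefficients.Default commutativeSemiring
    using (solve; _:+_; _:*_; _:^_) renaming (_:=_ to _:≈_)

  -- The mixed terms of the binomial expansion have coefficient 3 = 0.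
  cube-⊕ : ∀ u v → (u ⊕ v) ↑ 3 ≡ (u ↑ 3) ⊕ (v ↑ 3)
  cube-⊕ u v = trans
    (solve 2 (λ u v → (u :+ v) :^ 3 :≈ (u :^ 3 :+ v :^ 3) :+
                      (((u :* u :* v :+ u :* v :* v) :+ (u :* u :* v :+ u :* v :* v)) :+
                       (u :* u :* v :+ u :* v :* v)))
           refl u v)
    (horn [] (x₀ :⊕ (x₁ :⊕ x₁ :⊕ x₁) := x₀) ((u ↑ 3) ⊕ (v ↑ 3) ∷ ((u * u) * v) ⊕ ((u * v) * v) ∷ []) [])

  frobenius-⊕ : ∀ j u v → (u ⊕ v) ↑ (3 ^ j) ≡ (u ↑ (3 ^ j)) ⊕ (v ↑ (3 ^ j))
  frobenius-⊕ zero    u v = trans (*-identityʳ (u ⊕ v)) (cong₂ _⊕_ (sym (*-identityʳ u)) (sym (*-identityʳ v)))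
  frobenius-⊕ (suc j) u v = begin
    (u ⊕ v) ↑ (3 ^ suc j)                    ≡⟨ ^-assocʳ (u ⊕ v) 3 (3 ^ j) ⟨
    ((u ⊕ v) ↑ 3) ↑ (3 ^ j)                  ≡⟨ cong (_↑ (3 ^ j)) (cube-⊕ u v) ⟩
    ((u ↑ 3) ⊕ (v ↑ 3)) ↑ (3 ^ j)            ≡⟨ frobenius-⊕ j (u ↑ 3) (v ↑ 3) ⟩
    ((u ↑ 3) ↑ (3 ^ j)) ⊕ ((v ↑ 3) ↑ (3 ^ j)) ≡⟨ cong₂ _⊕_ (^-assocʳ u 3 (3 ^ j)) (^-assocʳ v 3 (3 ^ j)) ⟩
    (u ↑ (3 ^ suc j)) ⊕ (v ↑ (3 ^ suc j))    ∎
    where open ≡-Reasoning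

  𝟏↑ : ∀ k → 𝟏 ↑ k ≡ 𝟏
  𝟏↑ zero    = refl
  𝟏↑ (suc k) = trans (*-identityˡ (𝟏 ↑ k)) (𝟏↑ k)

module Companion {n′ : ℕ} (r : Pt (suc n′)) where
  n = suc n′

  -- The last entry falls out and is recovered by `lastOr`, whose first argument is the entry just
  -- passed, hence the answer once the vector is exhausted.
  shiftIn : ∀ {k} → F₃ → Pt k → Pt k
  shiftIn c []      = []
  shiftIn c (d ∷ v) = c ∷ shiftIn d v

  lastOr : ∀ {k} → F₃ → Pt k → F₃
  lastOr c []      = c
  lastOr c (d ∷ v) = lastOr d v

  -- Multiplication by X in 𝔽₃[X]/(Xⁿ − r), vectors listing coefficients from the constant term up.
  S : Pt n → Pt n
  S v = shiftIn zero v ⊕ (lastOr zero v · r)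

  -- act v is v(S).  Operators of this form commute, and v(S) 𝟏 = v when v has length n: this makes
  -- (u , v) ↦ u(S) v a commutative and associative product.
  act : ∀ {k} → Pt k → Pt n → Pt n
  act []      w = 𝟎
  act (c ∷ v) w = (c · w) ⊕ S (act v w)

  shiftIn-⊕ : ∀ {k} c d (u v : Pt k) → shiftIn (c +₃ d) (u ⊕ v) ≡ shiftIn c u ⊕ shiftIn d v
  shiftIn-⊕ c d []      []      = refl
  shiftIn-⊕ c d (a ∷ u) (b ∷ v) = cong (_ ∷_) (shiftIn-⊕ a b u v)

  lastOr-⊕ : ∀ {k} c d (u v : Pt k) → lastOr (c +₃ d) (u ⊕ v) ≡ lastOr c u +₃ lastOr d v
  lastOr-⊕ c d []      []      = refl
  lastOr-⊕ c d (a ∷ u) (b ∷ v) = lastOr-⊕ a b u v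

  S-⊕ : ∀ u v → S (u ⊕ v) ≡ S u ⊕ S v
  S-⊕ u v = trans
    (cong₂ _⊕_ (shiftIn-⊕ zero zero u v)
               (trans (cong (_· r) (lastOr-⊕ zero zero u v)) (·-distribʳ-+₃ (lastOr zero u) (lastOr zero v) r)))
    (⊕-interchange _ _ _ _)

  act-⊕ʳ : ∀ {k} (v : Pt k) w w′ → act v (w ⊕ w′) ≡ act v w ⊕ act v w′
  act-⊕ʳ []      w w′ = sym (⊕-identityˡ 𝟎)
  act-⊕ʳ (c ∷ v) w w′ = trans
    (cong₂ _⊕_ (·-distribˡ-⊕ c w w′) (trans (cong S (act-⊕ʳ v w w′)) (S-⊕ (act v w) (act v w′))))
    (⊕-interchange _ _ _ _)

  act-⊕ˡ : ∀ {k} (u v : Pt k) w → act (u ⊕ v) w ≡ act u w ⊕ act v w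
  act-⊕ˡ []      []      w = sym (⊕-identityˡ 𝟎)
  act-⊕ˡ (c ∷ u) (d ∷ v) w = trans
    (cong₂ _⊕_ (·-distribʳ-+₃ c d w) (trans (cong S (act-⊕ˡ u v w)) (S-⊕ (act u w) (act v w))))
    (⊕-interchange _ _ _ _)

  act-S : ∀ {k} (v : Pt k) w → act v (S w) ≡ S (act v w)
  act-S []      w = sym (additive-𝟎 S-⊕)
  act-S (c ∷ v) w = trans
    (cong₂ _⊕_ (sym (additive-· S-⊕ c w)) (cong S (act-S v w)))
    (sym (S-⊕ (c · w) (S (act v w))))

  act-comm : ∀ {k l} (u : Pt k) (v : Pt l) w → act u (act v w) ≡ act v (act u w)
  act-comm u []      w = additive-𝟎 (act-⊕ʳ u)
  act-comm u (c ∷ v) w = trans (act-⊕ʳ u (c · w) (S (act v w)))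
    (cong₂ _⊕_ (additive-· (act-⊕ʳ u) c w) (trans (act-S u (act v w)) (cong S (act-comm u v w))))

  -- Allows an induction over the entries of a vector while the ambient space stays 𝔽₃ⁿ.
  pad : ∀ {k} l → Pt k → Pt l
  pad l       []      = 𝟎
  pad zero    (c ∷ v) = []
  pad (suc l) (c ∷ v) = c ∷ pad l v

  pad-id : ∀ {k} (v : Pt k) → pad k v ≡ v
  pad-id []      = refl
  pad-id (c ∷ v) = cong (c ∷_) (pad-id v)

  shiftIn-𝟎 : ∀ l c → shiftIn c (𝟎 {suc l}) ≡ c ∷ 𝟎
  shiftIn-𝟎 zero    c = refl
  shiftIn-𝟎 (suc l) c = cong (c ∷_) (shiftIn-𝟎 l zero)

  lastOr-𝟎 : ∀ l → lastOr zero (𝟎 {l}) ≡ zero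
  lastOr-𝟎 zero    = refl
  lastOr-𝟎 (suc l) = lastOr-𝟎 l

  shiftIn-pad : ∀ {k} l c (v : Pt k) → k ≤ l → shiftIn c (pad (suc l) v) ≡ c ∷ pad l v
  shiftIn-pad l       c []      _         = shiftIn-𝟎 l c
  shiftIn-pad (suc l) c (d ∷ v) (s≤s k≤l) = cong (c ∷_) (shiftIn-pad l d v k≤l)

  lastOr-pad : ∀ {k} l c (v : Pt k) → k ≤ l → lastOr c (pad (suc l) v) ≡ zero
  lastOr-pad l       c []      _         = lastOr-𝟎 l
  lastOr-pad (suc l) c (d ∷ v) (s≤s k≤l) = lastOr-pad l d v k≤l

  𝟏 : Pt n
  𝟏 = 1₃ ∷ 𝟎

  -- Horner evaluation at X: as long as at most n coefficients are involved, every shift pushes out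
  -- a zero and r never enters.
  act-𝟏-pad : ∀ {k} (v : Pt k) → k ≤ n → act v 𝟏 ≡ pad n v
  act-𝟏-pad []      _         = refl
  act-𝟏-pad (c ∷ v) (s≤s k≤n′) = begin
    (c · 𝟏) ⊕ S (act v 𝟏)         ≡⟨ cong (λ w → (c · 𝟏) ⊕ S w) (act-𝟏-pad v (ℕ.m≤n⇒m≤1+n k≤n′)) ⟩
    (c · 𝟏) ⊕ S (pad n v)         ≡⟨ cong ((c · 𝟏) ⊕_) (cong₂ (λ u d → u ⊕ (d · r))
                                          (shiftIn-pad n′ zero v k≤n′) (lastOr-pad n′ zero v k≤n′)) ⟩
    (c · 𝟏) ⊕ ((zero ∷ pad n′ v) ⊕ (zero · r))
                                  ≡⟨ cong ((c · 𝟏) ⊕_) (trans (cong ((zero ∷ pad n′ v) ⊕_) (0·-≡𝟎 r)) (⊕-identityʳ _)) ⟩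
    (c · 𝟏) ⊕ (zero ∷ pad n′ v)   ≡⟨ cong₂ _∷_ (c*1+0 c) (trans (cong (_⊕ pad n′ v) (additive-𝟎 (·-distribˡ-⊕ c)))
                                                         (⊕-identityˡ (pad n′ v))) ⟩
    c ∷ pad n′ v                  ∎
    where
    open ≡-Reasoning
    c*1+0 : ∀ c → (c *₃ 1₃) +₃ zero ≡ c
    c*1+0 zero = refl
    c*1+0 1₃   = refl
    c*1+0 2₃   = refl

  act-𝟏 : ∀ v → act v 𝟏 ≡ v
  act-𝟏 v = trans (act-𝟏-pad v ℕ.≤-refl) (pad-id v)

  act-commutative : ∀ u v → act u v ≡ act v u
  act-commutative u v = begin
    act u v         ≡⟨ cong (act u) (act-𝟏 v) ⟨
    act u (act v 𝟏) ≡⟨ act-comm u v 𝟏 ⟩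
    act v (act u 𝟏) ≡⟨ cong (act v) (act-𝟏 u) ⟩
    act v u         ∎
    where open ≡-Reasoning

  quotientAlgebra : Algebra n
  quotientAlgebra = record
    { _*_ = act
    ; 𝟏 = 𝟏
    ; *-assoc = λ u v w → trans (act-commutative (act u v) w)
                          (trans (act-comm w u v) (cong (act u) (act-commutative w v)))
    ; *-comm = act-commutative
    ; *-identityˡ = λ u → trans (act-commutative 𝟏 u) (act-𝟏 u)
    ; *-distribˡ-⊕ = act-⊕ʳ
    }

  open Algebra quotientAlgebra using (_*_; *-identityˡ; *-identityʳ; *-assoc; *-distribʳ-⊕)
  open Frobenius quotientAlgebra using (_↑_; 𝟏↑; frobenius-⊕; ^-distrib-*)

  X : Pt n
  X = S 𝟏

  X*-≡S : ∀ v → X * v ≡ S v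
  X*-≡S v = trans (act-commutative X v) (trans (act-S v 𝟏) (cong S (act-𝟏 v)))

  -- Identifies the last basis vector with X^(n-1); one more shift then wraps it around to r.
  act-monomial : ∀ k w → act (replicate k zero ∷ʳ 1₃) w ≡ (X ↑ k) * w
  act-monomial zero    w = trans (cong₂ _⊕_ (1·-≡ w) (additive-𝟎 S-⊕)) (trans (⊕-identityʳ w) (sym (*-identityˡ w)))
  act-monomial (suc k) w = begin
    (zero · w) ⊕ S (act (replicate k zero ∷ʳ 1₃) w) ≡⟨ cong₂ _⊕_ (0·-≡𝟎 w) (cong S (act-monomial k w)) ⟩
    𝟎 ⊕ S ((X ↑ k) * w)                             ≡⟨ ⊕-identityˡ _ ⟩
    S ((X ↑ k) * w)                                 ≡⟨ X*-≡S _ ⟨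
    X * ((X ↑ k) * w)                               ≡⟨ *-assoc X (X ↑ k) w ⟨
    (X ↑ suc k) * w                                 ∎
    where open ≡-Reasoning

  shiftIn-monomial : ∀ k c d → shiftIn c (replicate k zero ∷ʳ d) ≡ c ∷ replicate k zero
  shiftIn-monomial zero    c d = refl
  shiftIn-monomial (suc k) c d = cong (c ∷_) (shiftIn-monomial k zero d)

  lastOr-monomial : ∀ k c d → lastOr c (replicate k zero ∷ʳ d) ≡ d
  lastOr-monomial zero    c d = refl
  lastOr-monomial (suc k) c d = lastOr-monomial k zero d

  X↑n : X ↑ n ≡ r
  X↑n = begin
    X * (X ↑ n′)                    ≡⟨ X*-≡S (X ↑ n′) ⟩
    S (X ↑ n′)                      ≡⟨ cong S (*-identityʳ (X ↑ n′)) ⟨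
    S ((X ↑ n′) * 𝟏)                ≡⟨ cong S (act-monomial n′ 𝟏) ⟨
    S (act (replicate n′ zero ∷ʳ 1₃) 𝟏) ≡⟨ cong S (act-𝟏 _) ⟩
    S (replicate n′ zero ∷ʳ 1₃)     ≡⟨ cong₂ (λ u c → u ⊕ (c · r))
                                         (shiftIn-monomial n′ zero 1₃) (lastOr-monomial n′ zero 1₃) ⟩
    𝟎 ⊕ (1₃ · r)                    ≡⟨ trans (⊕-identityˡ _) (1·-≡ r) ⟩
    r                               ∎
    where open ≡-Reasoning

  -- The map v ↦ v^(3^j) is additive, multiplicative and 𝔽₃-linear; fixing X, it fixes every
  -- polynomial in X, by induction along Horner's scheme.
  X-fixed⇒all-fixed : ∀ j → X ↑ (3 ^ j) ≡ X → ∀ v → v ↑ (3 ^ j) ≡ v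
  X-fixed⇒all-fixed j X-fixed v = subst (λ w → w ↑ (3 ^ j) ≡ w) (act-𝟏 v) (polynomial-fixed v)
    where
    polynomial-fixed : ∀ {k} (v : Pt k) → act v 𝟏 ↑ (3 ^ j) ≡ act v 𝟏
    polynomial-fixed []      = additive-𝟎 (frobenius-⊕ j)
    polynomial-fixed (c ∷ v) = begin
      ((c · 𝟏) ⊕ S (act v 𝟏)) ↑ (3 ^ j)
        ≡⟨ frobenius-⊕ j (c · 𝟏) _ ⟩
      ((c · 𝟏) ↑ (3 ^ j)) ⊕ (S (act v 𝟏) ↑ (3 ^ j))
        ≡⟨ cong₂ _⊕_ (additive-· (frobenius-⊕ j) c 𝟏) (cong (_↑ (3 ^ j)) (sym (X*-≡S _))) ⟩
      (c · (𝟏 ↑ (3 ^ j))) ⊕ ((X * act v 𝟏) ↑ (3 ^ j))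
        ≡⟨ cong₂ _⊕_ (cong (c ·_) (𝟏↑ (3 ^ j))) (^-distrib-* X _ (3 ^ j)) ⟩
      (c · 𝟏) ⊕ ((X ↑ (3 ^ j)) * (act v 𝟏 ↑ (3 ^ j)))
        ≡⟨ cong ((c · 𝟏) ⊕_) (cong₂ _*_ X-fixed (polynomial-fixed v)) ⟩
      (c · 𝟏) ⊕ (X * act v 𝟏)
        ≡⟨ cong ((c · 𝟏) ⊕_) (X*-≡S _) ⟩
      (c · 𝟏) ⊕ S (act v 𝟏) ∎
      where open ≡-Reasoning

  -- Degrees and leading coefficients

  coef : ∀ {k} → Pt k → ℕ → F₃
  coef []      i       = zero
  coef (c ∷ v) zero    = c
  coef (c ∷ v) (suc i) = coef v i

  coef-⊕ : ∀ {k} (u v : Pt k) i → coef (u ⊕ v) i ≡ coef u i +₃ coef v i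
  coef-⊕ []      []      i       = refl
  coef-⊕ (c ∷ u) (d ∷ v) zero    = refl
  coef-⊕ (c ∷ u) (d ∷ v) (suc i) = coef-⊕ u v i

  coef-𝟎 : ∀ k i → coef (𝟎 {k}) i ≡ zero
  coef-𝟎 zero    i       = refl
  coef-𝟎 (suc k) zero    = refl
  coef-𝟎 (suc k) (suc i) = coef-𝟎 k i

  coef-shiftIn : ∀ {k} c (v : Pt k) i → suc i < k → coef (shiftIn c v) (suc i) ≡ coef v i
  coef-shiftIn c (d ∷ e ∷ v) zero    _         = refl
  coef-shiftIn c (d ∷ v)     (suc i) (s≤s i<k) = coef-shiftIn d v i i<k
  coef-shiftIn c (d ∷ [])    zero    (s≤s ())

  coef-overflow : ∀ {k} (v : Pt k) i → k ≤ i → coef v i ≡ zero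
  coef-overflow []      i       _         = refl
  coef-overflow (c ∷ v) (suc i) (s≤s k≤i) = coef-overflow v i k≤i

  lastOr-coef : ∀ {k} c (v : Pt (suc k)) → lastOr c v ≡ coef v k
  lastOr-coef {zero}  c (d ∷ []) = refl
  lastOr-coef {suc k} c (d ∷ v)  = lastOr-coef d v

  Degree<_ : ℕ → Pt n → Set
  (Degree< j) v = ∀ i → j ≤ i → coef v i ≡ zero

  Monic : ℕ → Pt n → Set
  Monic j v = coef v j ≡ 1₃ × (Degree< suc j) v

  Degree<-mono : ∀ {i j v} → i ≤ j → (Degree< i) v → (Degree< j) v
  Degree<-mono i≤j deg k j≤k = deg k (ℕ.≤-trans i≤j j≤k)

  Degree<-⊕ : ∀ {j u v} → (Degree< j) u → (Degree< j) v → (Degree< j) (u ⊕ v)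
  Degree<-⊕ {u = u} {v} du dv i j≤i = trans (coef-⊕ u v i) (cong₂ _+₃_ (du i j≤i) (dv i j≤i))

  Monic-⊕ : ∀ {j u v} → Monic j u → (Degree< j) v → Monic j (u ⊕ v)
  Monic-⊕ {j} {u} {v} (lead , du) dv =
    trans (coef-⊕ u v j) (cong₂ _+₃_ lead (dv j ℕ.≤-refl)) ,
    Degree<-⊕ {u = u} {v} du (Degree<-mono {v = v} (ℕ.n≤1+n j) dv)

  -- The bound j < n makes the top coefficient zero, so no reduction by r takes place.
  coef-S : ∀ {j v} → j < n → (Degree< j) v → ∀ i → suc i < n → coef (S v) (suc i) ≡ coef v i
  coef-S {j} {v} (s≤s j≤n′) deg i i<n = begin
    coef (S v) (suc i)
      ≡⟨ cong (λ c → coef (shiftIn zero v ⊕ (c · r)) (suc i)) (trans (lastOr-coef zero v) (deg n′ j≤n′)) ⟩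
    coef (shiftIn zero v ⊕ (zero · r)) (suc i)
      ≡⟨ cong (λ w → coef w (suc i)) (trans (cong (shiftIn zero v ⊕_) (0·-≡𝟎 r)) (⊕-identityʳ _)) ⟩
    coef (shiftIn zero v) (suc i) ≡⟨ coef-shiftIn zero v i i<n ⟩
    coef v i ∎
    where open ≡-Reasoning

  Degree<-X* : ∀ {j v} → j < n → (Degree< j) v → (Degree< suc j) (X * v)
  Degree<-X* {j} {v} j<n deg (suc i) (s≤s j≤i) with suc i ℕ.<? n
  ... | yes i<n = trans (cong (λ w → coef w (suc i)) (X*-≡S v)) (trans (coef-S {v = v} j<n deg i i<n) (deg i j≤i))
  ... | no i≮n  = coef-overflow (X * v) (suc i) (ℕ.≮⇒≥ i≮n)

  Monic-X* : ∀ {j v} → suc j < n → Monic j v → Monic (suc j) (X * v)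
  Monic-X* {j} {v} j<n (lead , deg) =
    trans (cong (λ w → coef w (suc j)) (X*-≡S v)) (trans (coef-S {v = v} j<n deg j j<n) lead) ,
    Degree<-X* {v = v} j<n deg

  Monic-X↑* : ∀ a {j v} → a + j < n → Monic j v → Monic (a + j) ((X ↑ a) * v)
  Monic-X↑* zero    {v = v} _ monic = subst (Monic _) (sym (*-identityˡ v)) monic
  Monic-X↑* (suc a) {v = v} a+j<n monic = subst (Monic _) (sym (*-assoc X (X ↑ a) v))
    (Monic-X* a+j<n (Monic-X↑* a (ℕ.<-trans (ℕ.n<1+n _) a+j<n) monic))

  Monic-𝟏 : Monic 0 𝟏
  Monic-𝟏 = refl , λ { (suc i) _ → coef-𝟎 n′ i }

  Monic⇒≢𝟎 : ∀ {j v} → Monic j v → v ≢ 𝟎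
  Monic⇒≢𝟎 {j} (lead , _) refl with () ← trans (sym (coef-𝟎 n j)) lead

  -- As 3 = 0, X ⊕ X is −X.
  Monic-[X↑a-X]* : ∀ a {j v} → 2 ≤ a → a + j < n → Monic j v →
                   Monic (a + j) (((X ↑ a) ⊕ (X ⊕ X)) * v)
  Monic-[X↑a-X]* a {j} {v} 2≤a a+j<n monic@(_ , deg) =
    subst (Monic (a + j))
      (sym (trans (*-distribʳ-⊕ v (X ↑ a) (X ⊕ X)) (cong (((X ↑ a) * v) ⊕_) (*-distribʳ-⊕ v X X))))
      (Monic-⊕ {u = (X ↑ a) * v} (Monic-X↑* a a+j<n monic) (Degree<-⊕ {u = X * v} Xv Xv))
    where
    -- `X * v` has degree at most j + 1, which is below the leading degree a + j because 2 ≤ a.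
    Xv : (Degree< (a + j)) (X * v)
    Xv = Degree<-mono {v = X * v} (ℕ.+-monoˡ-≤ j 2≤a)
      (Degree<-X* {v = v} (ℕ.≤-<-trans (ℕ.+-monoˡ-≤ j (ℕ.≤-trans (s≤s z≤n) 2≤a)) a+j<n) deg)

-- A primitive idempotent

module Differences {n} (A : Algebra n) (x : Pt n) where
  open Algebra A
  open Frobenius A

  difference : ℕ → Pt n
  difference d = (x ↑ (3 ^ d)) ⊕ (x ⊕ x)

  differences : ℕ → Pt n
  differences zero    = 𝟏
  differences (suc t) = difference (suc t) * differences t

  difference∣differences : ∀ {d t} → 0 < d → d ≤ t → ∃ λ w → differences t ≡ difference d * w
  difference∣differences {suc d} {suc t} 0<d d≤t with d ℕ.≟ t
  ... | yes refl = differences t , refl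
  ... | no d≢t with w , eq ← difference∣differences 0<d (ℕ.≤∧≢⇒< (ℕ.s≤s⁻¹ d≤t) d≢t) =
    difference (suc t) * w ,
    trans (cong (difference (suc t) *_) eq) (x∙yz≈y∙xz (difference (suc t)) (difference (suc d)) w)
    where open import Algebra.Properties.CommutativeSemigroup *-commutativeSemigroup using (x∙yz≈y∙xz)

degree : ℕ → ℕ
degree zero    = 0
degree (suc t) = 3 ^ suc t + degree t

-- A geometric sum: inductively 3^(t+1) + `degree t` < 2 · 3^(t+1) ≤ 3^(t+2).
degree< : ∀ t → degree t < 3 ^ suc t
degree< zero    = s≤s z≤n
degree< (suc t) = ℕ.+-monoʳ-< (3 ^ suc t) (ℕ.<-≤-trans (degree< t) (ℕ.m≤m+n (3 ^ suc t) _))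

-- Writing q = 3^m as 2 + M makes v^(q-1) and v^(q-2) available without subtraction.
2+pred2 : ∀ {k} → 2 ≤ k → ∃ λ M → k ≡ suc (suc M)
2+pred2 (s≤s (s≤s _)) = _ , refl

2≤3^suc : ∀ t → 2 ≤ 3 ^ suc t
2≤3^suc t = ℕ.≤-trans (s≤s (s≤s z≤n)) (ℕ.*-monoʳ-≤ 3 (ℕ.m^n>0 3 t))

-- The two conditions bound the dimension of a field component lying under the product of
-- differences: the first from above, the second from below.
SeparatedAlgebra : ℕ → Set
SeparatedAlgebra t = ∃ λ n → Σ (Algebra n) λ A → ∃ λ x →
  (∀ v → Frobenius._↑_ A v (3 ^ suc t) ≡ v) × Differences.differences A x t ≢ 𝟎

-- 𝔽₃[X]/(X^(3^m) − X) with m = suc t: the product of the X^(3^d) − X for 0 < d < m has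
-- degree less than 3^m, so it does not vanish there.
separatedAlgebra : ∀ t → SeparatedAlgebra t
separatedAlgebra t with M , 3^m≡2+M ← 2+pred2 (2≤3^suc t) =
  _ , quotientAlgebra , X , X-fixed⇒all-fixed (suc t) X-fixed , Monic⇒≢𝟎 (differences-Monic t ℕ.≤-refl)
  where
  -- Here r is X itself, so the defining relation is X^q = X with q = 2 + M.
  open Companion {suc M} (zero ∷ 1₃ ∷ 𝟎)
  open Frobenius quotientAlgebra using (_↑_)
  open Differences quotientAlgebra X

  X≡ : X ≡ zero ∷ 1₃ ∷ 𝟎
  X≡ = trans (cong₂ (λ u c → (zero ∷ u) ⊕ (c · (zero ∷ 1₃ ∷ 𝟎))) (shiftIn-𝟎 M 1₃) (lastOr-𝟎 M))
    (trans (cong ((zero ∷ 1₃ ∷ 𝟎) ⊕_) (0·-≡𝟎 (zero ∷ 1₃ ∷ 𝟎))) (⊕-identityʳ _))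

  X-fixed : X ↑ (3 ^ suc t) ≡ X
  X-fixed = trans (cong (X ↑_) 3^m≡2+M) (trans X↑n (sym X≡))

  differences-Monic : ∀ s → s ≤ t → Monic (degree s) (differences s)
  differences-Monic zero    _   = Monic-𝟏
  differences-Monic (suc s) s<t = Monic-[X↑a-X]* (3 ^ suc s) (2≤3^suc s)
    (subst (degree (suc s) <_) 3^m≡2+M (ℕ.<-≤-trans (degree< (suc s)) (ℕ.^-monoʳ-≤ 3 (s≤s s<t))))
    (differences-Monic s (ℕ.<⇒≤ s<t))

module Idempotent {n} (A : Algebra n) {M} (fixed : ∀ v → Frobenius._↑_ A v (2 + M) ≡ v)
                  (y : Pt n) (y≢𝟎 : y ≢ 𝟎) where
  open Algebra A
  open Frobenius A
  open import Algebra.Properties.CommutativeSemigroup *-commutativeSemigroup using (interchange; xy∙z≈xz∙y)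

  N : ℕ
  N = suc M

  -- With q = 2 + M: v^(q-1) v^(q-1) = v^q v^(q-2) = v v^(q-2).
  ↑N-idempotent : ∀ v → (v ↑ N) * (v ↑ N) ≡ v ↑ N
  ↑N-idempotent v = begin
    (v * (v ↑ M)) * (v ↑ N) ≡⟨ xy∙z≈xz∙y v (v ↑ M) (v ↑ N) ⟩
    (v * (v ↑ N)) * (v ↑ M) ≡⟨ cong (_* (v ↑ M)) (fixed v) ⟩
    v ↑ N                   ∎
    where open ≡-Reasoning

  -- `below-y` places e under the idempotent y^(q-1), so that y does not vanish in the component of
  -- e.
  record Good (e : Pt n) : Set where
    field
      nonzero    : e ≢ 𝟎
      idempotent : e * e ≡ e
      below-y    : e * (y ↑ N) ≡ e

  -- In the component of e, a is either zero or a unit with inverse e a^(q-2).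
  Decided : Pt n → Pt n → Set
  Decided e a = e * a ≡ 𝟎 ⊎ e * (a ↑ N) ≡ e

  e*a≡𝟎 : ∀ e a → e * (a ↑ N) ≡ 𝟎 → e * a ≡ 𝟎
  e*a≡𝟎 e a eq = begin
    e * a             ≡⟨ cong (e *_) (trans (*-comm (a ↑ N) a) (fixed a)) ⟨
    e * ((a ↑ N) * a) ≡⟨ *-assoc e (a ↑ N) a ⟨
    (e * (a ↑ N)) * a ≡⟨ cong (_* a) eq ⟩
    𝟎 * a             ≡⟨ zeroˡ a ⟩
    𝟎                 ∎
    where open ≡-Reasoning

  -- Shrinking the idempotent preserves earlier decisions, so a single pass over all elements is
  -- enough.
  Decided-* : ∀ {e} f {a} → Decided e a → Decided (e * f) a
  Decided-* {e} f {a} (inj₁ eq) = inj₁ (trans (xy∙z≈xz∙y e f a) (trans (cong (_* f) eq) (zeroˡ f)))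
  Decided-* {e} f {a} (inj₂ eq) = inj₂ (trans (xy∙z≈xz∙y e f (a ↑ N)) (cong (_* f) eq))

  -- Starting from y^(q-1), e shrinks to e a^(q-1) unless that is 0, in which case e a = e a^(q-1) a
  -- = 0.
  decideAll : ∀ as → ∃ λ e → Good e × All (Decided e) as
  decideAll [] = y ↑ N , record
    { nonzero    = λ eq → y≢𝟎 (trans (sym (fixed y)) (trans (cong (y *_) eq) (*-zeroʳ y)))
    ; idempotent = ↑N-idempotent y
    ; below-y    = ↑N-idempotent y } , []
  decideAll (a ∷ as) with e , good , decided ← decideAll as with (e * (a ↑ N)) ≟ 𝟎
  ... | yes eq = e , good , inj₁ (e*a≡𝟎 e a eq) ∷ decided
  ... | no neq = e * (a ↑ N) , record
    { nonzero    = neq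
    ; idempotent = trans (interchange e (a ↑ N) e (a ↑ N)) (cong₂ _*_ (Good.idempotent good) (↑N-idempotent a))
    ; below-y    = trans (xy∙z≈xz∙y e (a ↑ N) (y ↑ N)) (cong (_* (a ↑ N)) (Good.below-y good)) } ,
    inj₂ (trans (*-assoc e (a ↑ N) (a ↑ N)) (cong (e *_) (↑N-idempotent a))) ∷
    All.map (λ {b} → Decided-* (a ↑ N) {b}) decided

-- The component of an idempotent

combination : ∀ {n k} → Vec (Pt n) k → Pt k → Pt n
combination []       []       = 𝟎
combination (b ∷ bs) (c ∷ cs) = (c · b) ⊕ combination bs cs

combination-⊕ : ∀ {n k} (bs : Vec (Pt n) k) u v →
                combination bs (u ⊕ v) ≡ combination bs u ⊕ combination bs v
combination-⊕ []       []      []      = sym (⊕-identityˡ 𝟎)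
combination-⊕ (b ∷ bs) (c ∷ u) (d ∷ v) = trans
  (cong₂ _⊕_ (·-distribʳ-+₃ c d b) (combination-⊕ bs u v)) (⊕-interchange _ _ _ _)

Independent : ∀ {n k} → Vec (Pt n) k → Set
Independent bs = ∀ c → combination bs c ≡ 𝟎 → c ≡ 𝟎

Spans : ∀ {n k} → Vec (Pt n) k → Pt n → Set
Spans bs v = ∃ λ c → combination bs c ≡ v

spans? : ∀ {n k} (bs : Vec (Pt n) k) v → Dec (Spans bs v)
spans? bs v with Any.any? (λ c → combination bs c ≟ v) (points _)
... | yes any = yes (Any.satisfied any)
... | no ¬any = no λ (c , eq) → ¬any (lose (∈-points c) eq)

Independent-∷ : ∀ {n k} {bs : Vec (Pt n) k} {b} → Independent bs → ¬ Spans bs b → Independent (b ∷ bs)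
Independent-∷ {bs = bs} {b} ind ¬span (zero ∷ c) eq =
  cong (zero ∷_) (ind c (horn ((zero :· x₀ :⊕ x₁ := :0) ∷ []) (x₁ := :0) (b ∷ combination bs c ∷ []) (eq ∷ [])))
-- A nonzero coefficient puts `b` into the span: with w the rest of the combination, b = -w = w + w
-- here and b = w in the next clause.
Independent-∷ {bs = bs} {b} ind ¬span (1₃ ∷ c) eq = ⊥-elim (¬span (c ⊕ c , trans (combination-⊕ bs c c)
  (horn ((1₃ :· x₀ :⊕ x₁ := :0) ∷ []) (x₁ :⊕ x₁ := x₀) (b ∷ combination bs c ∷ []) (eq ∷ []))))
Independent-∷ {bs = bs} {b} ind ¬span (2₃ ∷ c) eq = ⊥-elim (¬span (c ,
  horn ((2₃ :· x₀ :⊕ x₁ := :0) ∷ []) (x₁ := x₀) (b ∷ combination bs c ∷ []) (eq ∷ [])))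

Spans-∷ : ∀ {n k} {bs : Vec (Pt n) k} b {v} → Spans bs v → Spans (b ∷ bs) v
Spans-∷ {bs = bs} b (c , eq) = zero ∷ c ,
  trans (horn [] (zero :· x₀ :⊕ x₁ := x₁) (b ∷ combination bs c ∷ []) []) eq

-- Greedy choice: a vector is kept exactly when it is outside the span of those kept so far.
extractBasis : ∀ {n} {P : Pt n → Set} (vs : List (Pt n)) → All P vs →
               ∃ λ k → Σ (Vec (Pt n) k) λ bs → Independent bs × VecAll P bs × All (Spans bs) vs
extractBasis []       []       = 0 , [] , (λ { [] _ → refl }) , [] , []
extractBasis (v ∷ vs) (p ∷ ps) with extractBasis vs ps
... | k , bs , ind , Pbs , spans with spans? bs v
... | yes span = k , bs , ind , Pbs , span ∷ spans
... | no ¬span = suc k , v ∷ bs , Independent-∷ ind ¬span , p ∷ Pbs ,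
  (1₃ ∷ 𝟎 , trans (cong ((1₃ · v) ⊕_) (additive-𝟎 (combination-⊕ bs)))
                  (horn [] (1₃ :· x₀ :⊕ :0 := x₀) (v ∷ []) [])) ∷ All.map (Spans-∷ v) spans

combination-injective : ∀ {n k} {bs : Vec (Pt n) k} → Independent bs →
                        ∀ {u v} → combination bs u ≡ combination bs v → u ≡ v
combination-injective {bs = bs} ind {u} {v} eq =
  horn ((x₀ :⊕ 2₃ :· x₁ := :0) ∷ []) (x₀ := x₁) (u ∷ v ∷ [])
    (ind (u ⊕ (2₃ · v)) (trans (combination-⊕ bs u (2₃ · v))
      (trans (cong₂ _⊕_ eq (additive-· (combination-⊕ bs) 2₃ v))
             (horn [] (x₀ :⊕ 2₃ :· x₀ := :0) (combination bs v ∷ []) []))) ∷ [])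

module Component {n} (A : Algebra n) {M} (fixed : ∀ v → Frobenius._↑_ A v (2 + M) ≡ v)
  (y : Pt n) (y≢𝟎 : y ≢ 𝟎) {e} (good : Idempotent.Good A {M} fixed y y≢𝟎 e)
  (decided : ∀ a → Idempotent.Decided A {M} fixed y y≢𝟎 e a) where

  open Algebra A
  open Frobenius A
  open Idempotent.Good good public using () renaming (nonzero to e≢𝟎; idempotent to e*e≡e)
  open import Algebra.Properties.CommutativeSemigroup *-commutativeSemigroup
    using (interchange; xy∙z≈xz∙y; x∙yz≈y∙xz)

  InComponent : Pt n → Set
  InComponent v = e * v ≡ v

  e*-inComponent : ∀ v → InComponent (e * v)
  e*-inComponent v = trans (sym (*-assoc e e v)) (cong (_* v) e*e≡e)

  -- If u is nonzero, it is a unit in the component, and v = e u^(q-1) v = e (u v) u^(q-2) = 0.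
  component-noZeroDivisors : ∀ {u v} → InComponent u → InComponent v → u * v ≡ 𝟎 → u ≡ 𝟎 ⊎ v ≡ 𝟎
  component-noZeroDivisors {u} {v} u∈ v∈ uv≡𝟎 with decided u
  ... | inj₁ eu≡𝟎 = inj₁ (trans (sym u∈) eu≡𝟎)
  ... | inj₂ euᴺ≡e = inj₂ (begin
    v                       ≡⟨ v∈ ⟨
    e * v                   ≡⟨ cong (_* v) euᴺ≡e ⟨
    (e * (u * (u ↑ M))) * v ≡⟨ xy∙z≈xz∙y e (u * (u ↑ M)) v ⟩
    (e * v) * (u * (u ↑ M)) ≡⟨ interchange e v u (u ↑ M) ⟩
    (e * u) * (v * (u ↑ M)) ≡⟨ *-assoc e u (v * (u ↑ M)) ⟩
    e * (u * (v * (u ↑ M))) ≡⟨ cong (e *_) (*-assoc u v (u ↑ M)) ⟨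
    e * ((u * v) * (u ↑ M)) ≡⟨ cong (λ w → e * (w * (u ↑ M))) uv≡𝟎 ⟩
    e * (𝟎 * (u ↑ M))       ≡⟨ trans (cong (e *_) (zeroˡ (u ↑ M))) (*-zeroʳ e) ⟩
    𝟎                       ∎)
    where open ≡-Reasoning

  abstract
    basis : ∃ λ k → Σ (Vec (Pt n) k) λ bs →
            Independent bs × VecAll InComponent bs × All (Spans bs) (List.map (e *_) (points n))
    basis = extractBasis (List.map (e *_) (points n))
              (All.map⁺ (All.universal e*-inComponent (points n)))

  k : ℕ
  k = proj₁ basis

  bs : Vec (Pt n) k
  bs = proj₁ (proj₂ basis)

  φ : Pt k → Pt n
  φ = combination bs

  φ-⊕ : ∀ u v → φ (u ⊕ v) ≡ φ u ⊕ φ v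
  φ-⊕ = combination-⊕ bs

  φ-injective : ∀ {u v} → φ u ≡ φ v → u ≡ v
  φ-injective = combination-injective {bs = bs} (proj₁ (proj₂ (proj₂ basis)))

  combination-inComponent : ∀ {k} {bs : Vec (Pt n) k} → VecAll InComponent bs → ∀ c → InComponent (combination bs c)
  combination-inComponent []         []      = *-zeroʳ e
  combination-inComponent (b∈ ∷ bs∈) (c ∷ cs) = trans (*-distribˡ-⊕ e _ _)
    (cong₂ _⊕_ (trans (additive-· (*-distribˡ-⊕ e) c _) (cong (c ·_) b∈)) (combination-inComponent bs∈ cs))

  φ-inComponent : ∀ v → InComponent (φ v)
  φ-inComponent = combination-inComponent {bs = bs} (proj₁ (proj₂ (proj₂ (proj₂ basis))))

  φ-surjective : ∀ v → ∃ λ c → φ c ≡ e * v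
  φ-surjective v = All.lookup (All.map⁻ (proj₂ (proj₂ (proj₂ (proj₂ basis))))) (∈-points v)

  -- Coordinates of the projection e v to the component; on the component itself it inverts φ.
  ψ : Pt n → Pt k
  ψ v = proj₁ (φ-surjective v)

  φ-ψ : ∀ v → φ (ψ v) ≡ e * v
  φ-ψ v = proj₂ (φ-surjective v)

  _⊛_ : Pt k → Pt k → Pt k
  u ⊛ v = ψ (φ u * φ v)

  φ-⊛ : ∀ u v → φ (u ⊛ v) ≡ φ u * φ v
  φ-⊛ u v = trans (φ-ψ (φ u * φ v)) (trans (sym (*-assoc e (φ u) (φ v))) (cong (_* φ v) (φ-inComponent u)))

  φ-ψe : φ (ψ e) ≡ e
  φ-ψe = trans (φ-ψ e) e*e≡e

  componentAlgebra : Algebra k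
  componentAlgebra = record
    { _*_ = _⊛_
    ; 𝟏 = ψ e
    ; *-assoc = λ u v w → φ-injective (begin
        φ ((u ⊛ v) ⊛ w)     ≡⟨ trans (φ-⊛ (u ⊛ v) w) (cong (_* φ w) (φ-⊛ u v)) ⟩
        (φ u * φ v) * φ w   ≡⟨ *-assoc (φ u) (φ v) (φ w) ⟩
        φ u * (φ v * φ w)   ≡⟨ trans (φ-⊛ u (v ⊛ w)) (cong (φ u *_) (φ-⊛ v w)) ⟨
        φ (u ⊛ (v ⊛ w))     ∎)
    ; *-comm = λ u v → cong ψ (*-comm (φ u) (φ v))
    ; *-identityˡ = λ u → φ-injective (trans (φ-⊛ (ψ e) u) (trans (cong (_* φ u) φ-ψe) (φ-inComponent u)))
    ; *-distribˡ-⊕ = λ u v w → φ-injective (begin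
        φ (u ⊛ (v ⊕ w))             ≡⟨ trans (φ-⊛ u (v ⊕ w)) (cong (φ u *_) (φ-⊕ v w)) ⟩
        φ u * (φ v ⊕ φ w)           ≡⟨ *-distribˡ-⊕ (φ u) (φ v) (φ w) ⟩
        (φ u * φ v) ⊕ (φ u * φ w)   ≡⟨ trans (φ-⊕ (u ⊛ v) (u ⊛ w)) (cong₂ _⊕_ (φ-⊛ u v) (φ-⊛ u w)) ⟨
        φ ((u ⊛ v) ⊕ (u ⊛ w))       ∎)
    }
    where open ≡-Reasoning

  open Frobenius componentAlgebra public using () renaming (_↑_ to _⇑_)

  -- The unit of the component is e instead of 𝟏; the factor e accounts for j = 0.
  φ-⇑ : ∀ u j → φ (u ⇑ j) ≡ e * (φ u ↑ j)
  φ-⇑ u zero    = trans φ-ψe (sym (*-identityʳ e))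
  φ-⇑ u (suc j) = trans (φ-⊛ u (u ⇑ j)) (trans (cong (φ u *_) (φ-⇑ u j)) (x∙yz≈y∙xz (φ u) e (φ u ↑ j)))

  φ-𝟎 : φ 𝟎 ≡ 𝟎
  φ-𝟎 = additive-𝟎 φ-⊕

  ⊛-noZeroDivisors : Algebra.NoZeroDivisors componentAlgebra
  ⊛-noZeroDivisors u v uv≡𝟎 =
    Sum.map (λ eq → φ-injective (trans eq (sym φ-𝟎))) (λ eq → φ-injective (trans eq (sym φ-𝟎)))
      (component-noZeroDivisors (φ-inComponent u) (φ-inComponent v)
        (trans (sym (φ-⊛ u v)) (trans (cong φ uv≡𝟎) φ-𝟎)))

  ψe≢𝟎 : ψ e ≢ 𝟎
  ψe≢𝟎 eq = e≢𝟎 (trans (sym φ-ψe) (trans (cong φ eq) φ-𝟎))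

  ⇑-fixed : ∀ v → v ⇑ (2 + M) ≡ v
  ⇑-fixed v = φ-injective (trans (φ-⇑ v (2 + M)) (trans (cong (e *_) (fixed (φ v))) (φ-inComponent v)))

  e*↑ : ∀ v j → e * ((e * v) ↑ j) ≡ e * (v ↑ j)
  e*↑ v zero    = refl
  e*↑ v (suc j) = begin
    e * ((e * v) * ((e * v) ↑ j)) ≡⟨ x∙yz≈y∙xz e (e * v) _ ⟩
    (e * v) * (e * ((e * v) ↑ j)) ≡⟨ cong ((e * v) *_) (e*↑ v j) ⟩
    (e * v) * (e * (v ↑ j))       ≡⟨ interchange e v e (v ↑ j) ⟩
    (e * e) * (v * (v ↑ j))       ≡⟨ cong (_* (v * (v ↑ j))) e*e≡e ⟩
    e * (v * (v ↑ j))             ∎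
    where open ≡-Reasoning

  -- Brings a Frobenius relation of the component back to the whole algebra, at the price of a
  -- factor e.
  ψ-⇑-fixed : ∀ v j → ψ v ⇑ j ≡ ψ v → e * (v ↑ j) ≡ e * v
  ψ-⇑-fixed v j eq = begin
    e * (v ↑ j)       ≡⟨ e*↑ v j ⟨
    e * ((e * v) ↑ j) ≡⟨ cong (λ w → e * (w ↑ j)) (φ-ψ v) ⟨
    e * (φ (ψ v) ↑ j) ≡⟨ φ-⇑ (ψ v) j ⟨
    φ (ψ v ⇑ j)       ≡⟨ cong φ eq ⟩
    φ (ψ v)           ≡⟨ φ-ψ v ⟩
    e * v             ∎
    where open ≡-Reasoning

-- Finite fields

unique∧set⇒↭ : ∀ {A : Set} {xs ys : List A} → Unique xs → Unique ys →
               (∀ {x} → x ∈ xs → x ∈ ys) → (∀ {x} → x ∈ ys → x ∈ xs) → xs ↭ ys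
unique∧set⇒↭ uxs uys xs⊆ys ys⊆xs = ∼bag⇒↭ (unique∧set⇒bag uxs uys (mk⇔ xs⊆ys ys⊆xs))

module FiniteField {k} (F : Algebra k) (noZeroDivisors : Algebra.NoZeroDivisors F)
  (𝟏≢𝟎 : Algebra.𝟏 F ≢ 𝟎) where

  open Algebra F
  open Frobenius F
  open import Algebra.Solver.Ring.NaturalCoefficients.Default commutativeSemiring
    using (solve; _:+_; _:*_) renaming (_:=_ to _:≈_)

  *-cancelˡ : ∀ {c u v} → c ≢ 𝟎 → c * u ≡ c * v → u ≡ v
  *-cancelˡ {c} {u} {v} c≢𝟎 eq =
    [ (λ c≡𝟎 → ⊥-elim (c≢𝟎 c≡𝟎))
    , (λ δ≡𝟎 → horn ((x₀ :⊕ (x₁ :⊕ x₁) := :0) ∷ []) (x₀ := x₁) (u ∷ v ∷ []) (δ≡𝟎 ∷ [])) ]′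
    (noZeroDivisors c (u ⊕ (v ⊕ v)) (begin
      c * (u ⊕ (v ⊕ v))                ≡⟨ trans (*-distribˡ-⊕ c u (v ⊕ v)) (cong₂ _⊕_ eq (*-distribˡ-⊕ c v v)) ⟩
      (c * v) ⊕ ((c * v) ⊕ (c * v))    ≡⟨ horn [] (x₀ :⊕ (x₀ :⊕ x₀) := :0) (c * v ∷ []) [] ⟩
      𝟎                                ∎))
    where open ≡-Reasoning

  -- The coefficients are listed from the constant term up, with a leading coefficient 𝟏 left out.
  evalMonic : List (Pt k) → Pt k → Pt k
  evalMonic []      t = 𝟏
  evalMonic (c ∷ p) t = c ⊕ (t * evalMonic p t)

  -- Division by t − r, where −r is written r ⊕ r.
  factor : ∀ p r c → ∃ λ q → length q ≡ length p ×
           (∀ t → evalMonic (c ∷ p) t ≡ evalMonic (c ∷ p) r ⊕ ((t ⊕ (r ⊕ r)) * evalMonic q t))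
  factor [] r c = [] , refl , λ t → begin
    c ⊕ (t * 𝟏)                                 ≡⟨ cong (c ⊕_) (*-identityʳ t) ⟩
    c ⊕ t                                       ≡⟨ horn [] (x₀ :⊕ x₁ := (x₀ :⊕ x₂) :⊕ (x₁ :⊕ (x₂ :⊕ x₂)))
                                                        (c ∷ t ∷ r ∷ []) [] ⟩
    (c ⊕ r) ⊕ (t ⊕ (r ⊕ r))                     ≡⟨ cong₂ (λ v w → (c ⊕ v) ⊕ w) (*-identityʳ r) (*-identityʳ _) ⟨
    (c ⊕ (r * 𝟏)) ⊕ ((t ⊕ (r ⊕ r)) * 𝟏)         ∎
    where open ≡-Reasoning
  factor (d ∷ p) r c with q , |q|≡|p| , division ← factor p r d =
    -- Synthetic division: the constant term of the quotient is the value at r of the polynomial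
    -- left after removing `c`.
    E ∷ q , cong suc |q|≡|p| , λ t → begin
    c ⊕ (t * evalMonic (d ∷ p) t)
      ≡⟨ cong (λ v → c ⊕ (t * v)) (division t) ⟩
    c ⊕ (t * (E ⊕ ((t ⊕ (r ⊕ r)) * evalMonic q t)))
      -- Adding 3rE = 0 turns the claim into a semiring identity, since -r is written as 2r.
      ≡⟨ horn [] (x₀ := x₀ :⊕ (x₁ :⊕ x₁ :⊕ x₁)) (c ⊕ (t * (E ⊕ ((t ⊕ (r ⊕ r)) * evalMonic q t))) ∷ r * E ∷ []) [] ⟩
    (c ⊕ (t * (E ⊕ ((t ⊕ (r ⊕ r)) * evalMonic q t)))) ⊕ (((r * E) ⊕ (r * E)) ⊕ (r * E))
      ≡⟨ solve 5 (λ c t r E Q → (c :+ t :* (E :+ (t :+ (r :+ r)) :* Q)) :+ ((r :* E :+ r :* E) :+ r :* E) :≈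
                                (c :+ r :* E) :+ (t :+ (r :+ r)) :* (E :+ t :* Q)) refl c t r E (evalMonic q t) ⟩
    (c ⊕ (r * E)) ⊕ ((t ⊕ (r ⊕ r)) * (E ⊕ (t * evalMonic q t))) ∎
    where
    open ≡-Reasoning
    E = evalMonic (d ∷ p) r

  -- Without zero divisors, the roots other than r are roots of the quotient by t - r, whose degree
  -- is one less.
  roots≤degree : ∀ p {rs} → Unique rs → All (λ r → evalMonic p r ≡ 𝟎) rs → length rs ≤ length p
  roots≤degree []      []       []          = z≤n
  roots≤degree []      (_ ∷ _)  (p[r]≡𝟎 ∷ _) = ⊥-elim (𝟏≢𝟎 p[r]≡𝟎)
  roots≤degree (c ∷ p) []       []          = z≤n
  roots≤degree (c ∷ p) {r ∷ rs} (r∉rs ∷ unique) (p[r]≡𝟎 ∷ roots)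
    with q , |q|≡|p| , division ← factor p r c =
    s≤s (subst (length rs ≤_) |q|≡|p| (roots≤degree q unique (All.zipWith quotient-root (r∉rs , roots))))
    where
    quotient-root : ∀ {t} → r ≢ t × evalMonic (c ∷ p) t ≡ 𝟎 → evalMonic q t ≡ 𝟎
    quotient-root {t} (r≢t , p[t]≡𝟎) =
      [ (λ δ≡𝟎 → ⊥-elim (r≢t (horn ((x₀ :⊕ (x₁ :⊕ x₁) := :0) ∷ []) (x₁ := x₀) (t ∷ r ∷ []) (δ≡𝟎 ∷ [])))) , id ]′
      (noZeroDivisors (t ⊕ (r ⊕ r)) (evalMonic q t)
        (trans (sym (⊕-identityˡ _)) (trans (cong (_⊕ _) (sym p[r]≡𝟎)) (trans (sym (division t)) p[t]≡𝟎))))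

  evalMonic-power : ∀ j t → evalMonic (List.replicate j 𝟎) t ≡ t ↑ j
  evalMonic-power zero    t = refl
  evalMonic-power (suc j) t = trans (⊕-identityˡ _) (cong (t *_) (evalMonic-power j t))

  module _ {M} (fixed : ∀ v → v ↑ (2 + M) ≡ v) where

    -- All 3ᵏ elements are roots of T^q - T, where q = 2 + M.
    3^k≤ : 3 ^ k ≤ 2 + M
    3^k≤ = ℕ.≤-trans (ℕ.≤-reflexive (sym (length-points k)))
      -- The list encodes T^q - T, with -1 written as `𝟏 ⊕ 𝟏`; as the leading coefficient is left
      -- out, its length is the degree.
      (ℕ.≤-trans (roots≤degree (𝟎 ∷ (𝟏 ⊕ 𝟏) ∷ List.replicate M 𝟎) (points-unique k)
                              (All.universal root (points k)))
                 (ℕ.≤-reflexive (cong (2 +_) (length-replicate M))))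
      where
      root : ∀ t → evalMonic (𝟎 ∷ (𝟏 ⊕ 𝟏) ∷ List.replicate M 𝟎) t ≡ 𝟎
      root t = begin
        𝟎 ⊕ (t * ((𝟏 ⊕ 𝟏) ⊕ (t * evalMonic (List.replicate M 𝟎) t)))
          ≡⟨ cong (λ v → 𝟎 ⊕ (t * ((𝟏 ⊕ 𝟏) ⊕ (t * v)))) (evalMonic-power M t) ⟩
        𝟎 ⊕ (t * ((𝟏 ⊕ 𝟏) ⊕ (t ↑ suc M)))
          ≡⟨ cong (𝟎 ⊕_) (trans (*-distribˡ-⊕ t _ _)
               (cong₂ _⊕_ (trans (*-distribˡ-⊕ t 𝟏 𝟏) (cong₂ _⊕_ (*-identityʳ t) (*-identityʳ t))) (fixed t))) ⟩
        𝟎 ⊕ ((t ⊕ t) ⊕ t)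
          ≡⟨ trans (⊕-identityˡ _) (⊕-triple t) ⟩
        𝟎 ∎
        where open ≡-Reasoning

    units : List (Pt k)
    units = filter (λ v → ¬? (v ≟ 𝟎)) (points k)

    ∈-units : ∀ {v} → v ≢ 𝟎 → v ∈ units
    ∈-units = ∈-filter⁺ (λ v → ¬? (v ≟ 𝟎)) (∈-points _)

    units-≢𝟎 : ∀ {v} → v ∈ units → v ≢ 𝟎
    units-≢𝟎 = proj₂ ∘ ∈-filter⁻ (λ v → ¬? (v ≟ 𝟎)) {xs = points k}

    units-unique : Unique units
    units-unique = Unique.filter⁺ (λ v → ¬? (v ≟ 𝟎)) (points-unique k)

    suc-length-units : suc (length units) ≡ 3 ^ k
    suc-length-units = trans
      (↭-length (unique∧set⇒↭ (All.tabulate (λ v∈ 𝟎≡v → units-≢𝟎 v∈ (sym 𝟎≡v)) ∷ units-unique)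
                              (points-unique k) (λ {v} _ → ∈-points v) 𝟎∷units-complete))
      (length-points k)
      where
      𝟎∷units-complete : ∀ {v} → v ∈ points k → v ∈ 𝟎 ∷ units
      𝟎∷units-complete {v} _ with v ≟ 𝟎
      ... | yes refl = here refl
      ... | no v≢𝟎  = there (∈-units v≢𝟎)

    *-≢𝟎 : ∀ {u v} → u ≢ 𝟎 → v ≢ 𝟎 → u * v ≢ 𝟎
    *-≢𝟎 u≢𝟎 v≢𝟎 uv≡𝟎 = [ u≢𝟎 , v≢𝟎 ]′ (noZeroDivisors _ _ uv≡𝟎)

    inverse : ∀ {c} → c ≢ 𝟎 → c * (c ↑ M) ≡ 𝟏
    inverse {c} c≢𝟎 = *-cancelˡ c≢𝟎 (trans (fixed c) (sym (*-identityʳ c)))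

    -- Multiplication by c is injective by cancellation, and reaches v from c^(q-2) v.
    map-units-↭ : ∀ {c} → c ≢ 𝟎 → List.map (c *_) units ↭ units
    map-units-↭ {c} c≢𝟎 = unique∧set⇒↭ (Unique.map⁺ (*-cancelˡ c≢𝟎) units-unique) units-unique
      (λ v∈ → let u , u∈ , v≡cu = ∈-map⁻ (c *_) v∈ in
              ∈-units (subst (_≢ 𝟎) (sym v≡cu) (*-≢𝟎 c≢𝟎 (units-≢𝟎 u∈))))
      (λ {v} v∈ → let v≡ = c*c⁻¹v v in
              subst (_∈ List.map (c *_) units) v≡ (∈-map⁺ (c *_) (∈-units λ eq →
                units-≢𝟎 v∈ (trans (sym v≡) (trans (cong (c *_) eq) (*-zeroʳ c))))))
      where
      c*c⁻¹v : ∀ v → c * ((c ↑ M) * v) ≡ v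
      c*c⁻¹v v = trans (sym (*-assoc c (c ↑ M) v)) (trans (cong (_* v) (inverse c≢𝟎)) (*-identityˡ v))

    product : List (Pt k) → Pt k
    product = foldr _*_ 𝟏

    product-↭ : ∀ {us vs} → us ↭ vs → product us ≡ product vs
    product-↭ us↭vs = foldr-commMonoid (setoid (Pt k))
      (CommutativeMonoid.isCommutativeMonoid *-commutativeMonoid) (↭⇒↭ₛ us↭vs)

    product-map : ∀ c us → product (List.map (c *_) us) ≡ (c ↑ length us) * product us
    product-map c []       = sym (*-identityˡ 𝟏)
    product-map c (u ∷ us) = trans (cong ((c * u) *_) (product-map c us)) (interchange c u _ _)
      where open import Algebra.Properties.CommutativeSemigroup *-commutativeSemigroup using (interchange)

    product-≢𝟎 : ∀ {us} → All (_≢ 𝟎) us → product us ≢ 𝟎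
    product-≢𝟎 []       = 𝟏≢𝟎
    product-≢𝟎 (u ∷ us) = *-≢𝟎 u (product-≢𝟎 us)

    -- Multiplication by v permutes the units, so their product equals itself times v^(3ᵏ-1), and
    -- cancelling it leaves v^(3ᵏ-1) = 1.
    fermat-units : ∀ v → v ≢ 𝟎 → v ↑ (3 ^ k) ≡ v
    fermat-units v v≢𝟎 = begin
      v ↑ (3 ^ k)             ≡⟨ cong (v ↑_) suc-length-units ⟨
      v * (v ↑ length units)  ≡⟨ cong (v *_) (*-cancelˡ (product-≢𝟎 (All.tabulate units-≢𝟎)) (begin
        product units * (v ↑ length units) ≡⟨ *-comm (product units) _ ⟩
        (v ↑ length units) * product units ≡⟨ product-map v units ⟨
        product (List.map (v *_) units)    ≡⟨ product-↭ (map-units-↭ v≢𝟎) ⟩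
        product units                      ≡⟨ *-identityʳ _ ⟨
        product units * 𝟏                  ∎)) ⟩
      v * 𝟏                   ≡⟨ *-identityʳ v ⟩
      v                       ∎
      where open ≡-Reasoning

    fermat : ∀ v → v ↑ (3 ^ k) ≡ v
    fermat v with v ≟ 𝟎
    ... | no v≢𝟎  = fermat-units v v≢𝟎
    ... | yes refl = additive-𝟎 (frobenius-⊕ k)

-- The dimension of the component, and the conclusion

3^-cancel-≤ : ∀ {j l} → 3 ^ j ≤ 3 ^ l → j ≤ l
3^-cancel-≤ 3^j≤3^l = ℕ.≮⇒≥ λ l<j → ℕ.<⇒≱ (ℕ.^-monoʳ-< 3 (s≤s (s≤s z≤n)) l<j) 3^j≤3^l

Domain : ℕ → Set
Domain m = Σ (Algebra m) Algebra.NoZeroDivisors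

module ComponentDomain {n} (A : Algebra n) {M} (fixed : ∀ v → Frobenius._↑_ A v (2 + M) ≡ v)
  (x : Pt n) {t} (3^m≡2+M : 3 ^ suc t ≡ 2 + M) (y≢𝟎 : Differences.differences A x t ≢ 𝟎)
  {e} (good : Idempotent.Good A {M} fixed (Differences.differences A x t) y≢𝟎 e)
  (decided : ∀ a → Idempotent.Decided A {M} fixed (Differences.differences A x t) y≢𝟎 e a) where

  open Algebra A
  open Frobenius A
  open Differences A x
  open Component A {M} fixed (differences t) y≢𝟎 good decided
  open FiniteField componentAlgebra ⊛-noZeroDivisors ψe≢𝟎

  -- With y the product of differences, e = e y^(q-1) = (e y) y^(q-2), so e y = 0 would give e = 0.
  e*differences≢𝟎 : e * differences t ≢ 𝟎
  e*differences≢𝟎 eq = e≢𝟎 (begin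
    e                                         ≡⟨ Idempotent.Good.below-y good ⟨
    e * (differences t * (differences t ↑ M)) ≡⟨ *-assoc e _ _ ⟨
    (e * differences t) * (differences t ↑ M) ≡⟨ cong (_* (differences t ↑ M)) eq ⟩
    𝟎 * (differences t ↑ M)                   ≡⟨ zeroˡ _ ⟩
    𝟎                                         ∎)
    where open ≡-Reasoning

  -- Otherwise e (x^(3^d) - x) = 0, and this is a factor of e times the product of differences.
  ψx-not-fixed : ∀ {d} → 0 < d → d ≤ t → ψ x ⇑ (3 ^ d) ≢ ψ x
  ψx-not-fixed {d} 0<d d≤t eq =
    e*differences≢𝟎 (begin
      e * differences t      ≡⟨ cong (e *_) y≡ ⟩
      e * (difference d * w) ≡⟨ *-assoc e _ w ⟨
      (e * difference d) * w ≡⟨ cong (_* w) e*difference≡𝟎 ⟩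
      𝟎 * w                  ≡⟨ zeroˡ w ⟩
      𝟎                      ∎)
    where
    open ≡-Reasoning
    w = proj₁ (difference∣differences 0<d d≤t)
    y≡ = proj₂ (difference∣differences 0<d d≤t)
    e*difference≡𝟎 : e * difference d ≡ 𝟎
    e*difference≡𝟎 = begin
      e * difference d                        ≡⟨ trans (*-distribˡ-⊕ e _ _)
                                                   (cong₂ _⊕_ (ψ-⇑-fixed x (3 ^ d) eq) (*-distribˡ-⊕ e x x)) ⟩
      (e * x) ⊕ ((e * x) ⊕ (e * x))           ≡⟨ horn [] (x₀ :⊕ (x₀ :⊕ x₀) := :0) (e * x ∷ []) [] ⟩
      𝟎                                       ∎

  0<k : 0 < k
  0<k = ℕ.n≢0⇒n>0 λ k≡0 → ψe≢𝟎 (dimension-zero k≡0 (ψ e))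
    where
    dimension-zero : ∀ {j} → j ≡ 0 → (v : Pt j) → v ≡ 𝟎
    dimension-zero refl [] = refl

  fermat-ψx : ψ x ⇑ (3 ^ k) ≡ ψ x
  fermat-ψx = fermat {M} ⇑-fixed (ψ x)

  3^k≤3^m : 3 ^ k ≤ 3 ^ suc t
  3^k≤3^m = subst (3 ^ k ≤_) (sym 3^m≡2+M) (3^k≤ {M} ⇑-fixed)

  -- Counting roots gives 3ᵏ ≤ 3^m. If k < m, Fermat would make x fixed under the 3ᵏ-th power in the
  -- component, although 0 < k ≤ t.
  k≡suc-t : k ≡ suc t
  k≡suc-t = ℕ.≤-antisym (3^-cancel-≤ 3^k≤3^m) (ℕ.≰⇒> λ k≤t → ψx-not-fixed 0<k k≤t fermat-ψx)

  component-domain : Domain (suc t)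
  component-domain = subst Domain k≡suc-t (componentAlgebra , ⊛-noZeroDivisors)

domain : ∀ m → Domain m
-- On the one-point space 𝔽₃⁰ the zero algebra serves: its only element is 𝟎.
domain zero = record
  { _*_ = λ _ _ → [] ; 𝟏 = []
  ; *-assoc = λ _ _ _ → refl ; *-comm = λ _ _ → refl
  ; *-identityˡ = λ { [] → refl } ; *-distribˡ-⊕ = λ _ _ _ → refl } , λ { [] _ _ → inj₁ refl }
domain (suc t) = fromAlgebra (2+pred2 (2≤3^suc t)) (separatedAlgebra t)
  where
  fromAlgebra : (∃ λ M → 3 ^ suc t ≡ 2 + M) → SeparatedAlgebra t → Domain (suc t)
  fromAlgebra (M , 3^m≡2+M) (n , A , x , fixed , y≢𝟎) = fromIdempotent (decideAll (points n))
    where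
    fixed′ : ∀ v → Frobenius._↑_ A v (2 + M) ≡ v
    fixed′ = subst (λ q → ∀ v → Frobenius._↑_ A v q ≡ v) 3^m≡2+M fixed

    open Idempotent A {M} fixed′ (Differences.differences A x t) y≢𝟎

    fromIdempotent : (∃ λ e → Good e × All (Decided e) (points n)) → Domain (suc t)
    fromIdempotent (e , good , decided) =
      ComponentDomain.component-domain A {M} fixed′ x {t} 3^m≡2+M y≢𝟎 good
        (λ a → All.lookup decided (∈-points a))

theorem3p6 : (n : ℕ) → 2 ∣ n → ∃ λ (Cs : List (List (Pt n))) → IsPartitionIntoMaximal2Caps n Cs
theorem3p6 n (divides m n≡m*2) with A , noZeroDivisors ← domain m =
  -- Divisibility gives n = m * 2, while the parabolas live in dimension m + m.
  subst (λ n → ∃ (IsPartitionIntoMaximal2Caps n))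
    (sym (trans n≡m*2 (trans (ℕ.*-comm m 2) (cong (m +_) (ℕ.+-identityʳ m)))))
    (Parabolas.partition A noZeroDivisors)
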